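{- There is a positive constant $c$ such that for infinitely many positive integers $n$, $$h(n)\le \frac{n}{4}-c\log\log n .$$
   Context: All graphs are finite and simple; $d_G(u,v)$ denotes the shortest-path distance between $u$ and $v$ in $G$. For $S\subseteq V(G)$, the distance multiset $D(S)$ is the multiset $\{d_G(u,v): \{u,v\}\subseteq S,\ u\neq v\}$ of pairwise distances between vertices of $S$. Two vertex sets $S_1,S_2\subseteq V(G)$ are homometric if $D(S_1)=D(S_2)$. For a graph $G$, $h(G)$ is the largest integer $h$ such that there exist two disjoint homometric sets $S_1,S_2\subseteq V(G)$ with $|S_1|=|S_2|=h$. For a positive integer $n$, $h(n)=\min\{h(G): G \text{ is a graph on } n \text{ vertices}\}$. -}

module Defs where

open import Data.Nat using (ℕ; zero; suc; _+_; _*_; _≤_)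
open import Data.Bool using (Bool; true; false; _∨_; _∧_; if_then_else_)
open import Data.Fin using (Fin)
open import Data.Maybe using (Maybe; just; nothing)
open import Data.List using (List; []; _∷_; map; _++_; length; allFin)
open import Data.Bool.ListAction using (any)
open import Data.List.Membership.Propositional using (_∈_; _∉_)
open import Data.List.Relation.Unary.Unique.Propositional using (Unique)
open import Data.List.Relation.Binary.Permutation.Propositional using (_↭_)
open import Data.Product using (_×_; _,_; Σ; ∃)
open import Relation.Binary.PropositionalEquality using (_≡_)
open import Relation.Nullary using (¬_)
open import Data.Fin.Properties using (_≟_)
open import Relation.Nullary.Decidable using (⌊_⌋)

record Graph (n : ℕ) : Set where
  field
    adj   : Fin n → Fin n → Bool
    sym   : ∀ u v → adj u v ≡ adj v u
    irrefl : ∀ u → adj u u ≡ false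
open Graph public

module _ {n : ℕ} (G : Graph n) where

  reach : ℕ → Fin n → Fin n → Bool
  reach zero    u v = ⌊ u ≟ v ⌋
  reach (suc k) u v = reach k u v ∨ any (λ w → adj G u w ∧ reach k w v) (allFin n)

  distSearch : ℕ → ℕ → Fin n → Fin n → Maybe ℕ
  distSearch zero     k u v = nothing
  distSearch (suc f)  k u v = if reach k u v then just k else distSearch f (suc k) u v

  -- shortest-path distance; nothing = ∞ (u and v in different components).
  -- Shortest paths in an n-vertex graph have length < n, so searching
  -- k = 0 .. n-1 suffices.
  dist : Fin n → Fin n → Maybe ℕ
  dist u v = distSearch n 0 u v

pairs : {A : Set} → List A → List (A × A)
pairs []       = []
pairs (x ∷ xs) = map (λ y → x , y) xs ++ pairs xs

-- the distance multiset D(S) of a vertex set S (given as a duplicate-free list),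
-- represented as a list considered up to permutation
D : {n : ℕ} → Graph n → List (Fin n) → List (Maybe ℕ)
D G S = map (λ p → dist G (Data.Product.proj₁ p) (Data.Product.proj₂ p)) (pairs S)

Homometric : {n : ℕ} → Graph n → List (Fin n) → List (Fin n) → Set
Homometric G S₁ S₂ = D G S₁ ↭ D G S₂

Disjoint : {n : ℕ} → List (Fin n) → List (Fin n) → Set
Disjoint S₁ S₂ = ∀ x → x ∈ S₁ → x ∉ S₂

HasHomPair : {n : ℕ} → Graph n → ℕ → Set
HasHomPair G h =
  Σ (List _) λ S₁ → Σ (List _) λ S₂ →
    Unique S₁ × Unique S₂ × length S₁ ≡ h × length S₂ ≡ h ×
    Disjoint S₁ S₂ × Homometric G S₁ S₂

IsH : {n : ℕ} → Graph n → ℕ → Set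
IsH G h = HasHomPair G h × (∀ h' → HasHomPair G h' → h' ≤ h)

IsHn : ℕ → ℕ → Set
IsHn n h = (Σ (Graph n) λ G → IsH G h) ×
           (∀ (G : Graph n) h' → IsH G h' → h ≤ h')

{-# OPTIONS --safe #-}

-- Let H be a disjoint union of r cliques of odd sizes, each clique having more than twice as many
-- vertices as there are pairs in all smaller ones, and attach a path with |H| − r + 1 vertices to H by
-- joining its first vertex to all of H. Let S₁, S₂ be disjoint homometric sets of the same size > 5.
--
-- If both meet H, consider the vertex of S₁ ∪ S₂ farthest from H: its distance to H is the largest
-- distance in its own set and, if it is at least 3, does not occur in the other one, so the path
-- contributes at most its first two vertices. Comparing the numbers of pairs at distance 1 clique by
-- clique, from the largest down, S₁ and S₂ either split every clique evenly or together miss at least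
-- r vertices of some clique. As the cliques are odd, S₁ ∪ S₂ misses at least r vertices of H anyway.
-- (If only one set contains the first vertex p of the path, all the counts are shifted by one, since
-- joining p to a clique of size c yields C(c + 1, 2) edges; this is incompatible with |S₁| = |S₂|.)
--
-- If S₁ lies on the path, its largest distance occurs once, whereas two vertices of S₂ in H would make
-- the largest distance of S₂ occur twice; so S₁ ∪ S₂ has at most one vertex outside the path.
--
-- Either way |S₁| + |S₂| ≤ |H| − r + 2 = (n − r + 3)/2, where n ≤ 2^(2^(2r)).
module Submission where

open import Defs
open import Algebra.Properties.CommutativeSemigroup using (interchange)
open import Data.Bool using (Bool; true; false; _∧_; _∨_; not; T)
open import Data.Bool.ListAction using (or)
open import Data.Bool.Properties using (∧-comm; ∧-zeroʳ; T-∨; T-∧)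
open import Data.Empty using (⊥; ⊥-elim)
open import Data.Fin as Fin using (Fin; toℕ; fromℕ<; finToFun; funToFin)
import Data.Fin.Properties as Fin
open import Data.List using (List; []; _∷_; _++_; length; map; filter; tabulate; lookup; allFin)
open import Data.List.Membership.Propositional using (_∈_; _∉_; find; lose)
open import Data.List.Membership.Propositional.Properties using (∈-∃++; ∈-lookup; ∈-++⁻; ∈-map⁻; ∈-allFin)
import Data.List.Membership.DecPropositional as DecMembership
open import Data.List.Properties using
  (tabulate-lookup; tabulate-cong; length-tabulate; map-cong; map-++; map-∘; length-++; length-map; filter-accept; filter-reject)
open import Data.List.Relation.Binary.Permutation.Propositional using (_↭_; prep; swap; refl; ↭-refl; ↭-sym; ↭-trans; ↭⇒↭ₛ)
open import Data.List.Relation.Binary.Permutation.Propositional.Properties as Perm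
  using (∈-resp-↭; All-resp-↭; ↭-length; shift; drop-∷; ¬x∷xs↭[])
import Data.List.Relation.Binary.Permutation.Setoid.Properties as Permₛ
open import Data.List.Relation.Unary.All as All using (All; []; _∷_)
import Data.List.Relation.Unary.All.Properties as All
open import Data.List.Relation.Unary.AllPairs using ([]; _∷_)
open import Data.List.Relation.Unary.Any using (here; there; any?)
open import Data.List.Relation.Unary.Any.Properties using (any⁺; any⁻)
open import Data.List.Relation.Unary.Unique.Propositional using (Unique)
import Data.List.Relation.Unary.Unique.Propositional.Properties as Unique
import Data.List.Relation.Unary.Unique.DecPropositional as DecUnique
open import Data.Maybe using (just; fromMaybe)
open import Data.Maybe.Properties using (≡-dec)
open import Data.Nat using (ℕ; zero; suc; _+_; _*_; _∸_; _^_; _≤_; _<_; _≡ᵇ_; _≟_; _≤?_; _<?_; ∣_-_∣; z≤n; s≤s)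
open import Data.Nat.ListAction using (sum)
open import Data.Nat.ListAction.Properties using (sum-++; sum-↭)
open import Data.Nat.Logarithm using (⌊log₂_⌋; ⌊log₂⌋-mono-≤; ⌊log₂[2^n]⌋≡n)
open import Data.Nat.Properties hiding (_≟_; _≤?_; _<?_)
open import Data.Nat.Tactic.RingSolver using (solve-∀)
open import Data.Product using (Σ; ∃; ∃₂; _×_; _,_; proj₁; proj₂)
open import Data.Sum using (_⊎_; inj₁; inj₂)
open import Data.Unit using (tt)
open import Function using (_∘_)
open import Function.Bundles using (Equivalence)
open import Relation.Binary using (DecidableEquality; tri<; tri≈; tri>)
open import Relation.Binary.PropositionalEquality as ≡ using (_≡_; _≢_; refl; trans; cong; cong₂; subst; subst₂) renaming (sym to ≡-sym)
open import Relation.Nullary using (Dec; yes; no; ¬_)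
open import Relation.Nullary.Decidable using (map′; _×-dec_; _→-dec_; ¬?; ⌊_⌋)

+-interchange : ∀ a b c d → (a + b) + (c + d) ≡ (a + c) + (b + d)
+-interchange = interchange +-commutativeSemigroup

-- Existence of `h(G)` and `h(n)` by finite search.

unique⇒lookup-injective : {A : Set} {xs : List A} → Unique xs →
                          ∀ {i j} → i Fin.< j → lookup xs i ≢ lookup xs j
unique⇒lookup-injective {xs = x ∷ xs} (x∉ ∷ u) {Fin.zero}  {Fin.suc j} _  eq =
  All.lookup x∉ (∈-lookup j) eq
unique⇒lookup-injective {xs = x ∷ xs} (x∉ ∷ u) {Fin.suc i} {Fin.suc j} lt eq =
  unique⇒lookup-injective u (≤-pred lt) eq

unique-length≤ : ∀ {n} {xs : List (Fin n)} → Unique xs → length xs ≤ n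
unique-length≤ {n} {xs} u = ≮⇒≥ λ lt → clash (Fin.pigeonhole lt (lookup xs))
  where
  clash : ¬ (∃₂ λ i j → i Fin.< j × lookup xs i ≡ lookup xs j)
  clash (i , j , i<j , eq) = unique⇒lookup-injective u i<j eq

module _ {A : Set} (_≟_ : DecidableEquality A) where
  open DecMembership _≟_ using (_∈?_)

  -- The head of the first list is deleted from an occurrence in the second; by `drop-∷` this loses
  -- no permutation, whichever occurrence is taken.
  _↭?_ : (xs ys : List A) → Dec (xs ↭ ys)
  [] ↭? []       = yes ↭-refl
  [] ↭? (y ∷ ys) = no (¬x∷xs↭[] ∘ ↭-sym)
  (x ∷ xs) ↭? ys with x ∈? ys
  ... | no x∉ = no λ p → x∉ (∈-resp-↭ p (here refl))
  ... | yes x∈ with ∈-∃++ x∈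
  ...   | as , bs , refl = map′ (λ p → ↭-trans (prep x p) (↭-sym (shift x as bs)))
                                (λ q → drop-∷ (↭-trans q (shift x as bs)))
                                (xs ↭? (as ++ bs))

module _ {n : ℕ} where
  open DecMembership (Fin._≟_ {n}) using (_∈?_)

  IsHomPair : Graph n → List (Fin n) → List (Fin n) → Set
  IsHomPair G S₁ S₂ = Unique S₁ × Unique S₂ × Disjoint S₁ S₂ × Homometric G S₁ S₂

  isHomPair? : ∀ G S₁ S₂ → Dec (IsHomPair G S₁ S₂)
  isHomPair? G S₁ S₂ = unique? S₁ ×-dec unique? S₂ ×-dec
    Fin.all? (λ x → (x ∈? S₁) →-dec ¬? (x ∈? S₂)) ×-dec _↭?_ (≡-dec _≟_) (D G S₁) (D G S₂)
    where open DecUnique (Fin._≟_ {n}) using (unique?)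

  -- Lists of length `h` are coded by a finite type, so that `Fin.any?` can search through all
  -- candidate sets.
  decode : ∀ h → Fin (n ^ h) → List (Fin n)
  decode h c = tabulate (finToFun {n} {h} c)

  encode : ∀ S → ∃ λ c → decode (length S) c ≡ S
  encode S = funToFin (lookup S) ,
    trans (tabulate-cong (Fin.finToFun-funToFin (lookup S))) (tabulate-lookup S)

  hasHomPair? : ∀ (G : Graph n) h → Dec (HasHomPair G h)
  hasHomPair? G h = map′ to from
    (Fin.any? λ c₁ → Fin.any? λ c₂ → isHomPair? G (decode h c₁) (decode h c₂))
    where
    to : _ → HasHomPair G h
    to (c₁ , c₂ , u₁ , u₂ , d , p) = decode h c₁ , decode h c₂ , u₁ , u₂ ,
      length-tabulate _ , length-tabulate _ , d , p
    from : HasHomPair G h → _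
    from (S₁ , S₂ , u₁ , u₂ , refl , l₂ , d , p) with encode S₁ | encode S₂
    ... | c₁ , e₁ | c₂ , e₂ rewrite l₂ =
      c₁ , c₂ , subst₂ (IsHomPair G) (≡-sym e₁) (≡-sym e₂) (u₁ , u₂ , d , p)

  hasHomPair-≤ : ∀ (G : Graph n) {h} → HasHomPair G h → h ≤ n
  hasHomPair-≤ G (_ , _ , u₁ , _ , refl , _) = unique-length≤ u₁

  isH-exists : ∀ (G : Graph n) → ∃ (IsH G)
  isH-exists G = search n λ _ → hasHomPair-≤ G
    where
    -- Downward search from the trivial bound `n`: the first size that is attained is the maximum,
    -- and the empty sets stop the search at 0.
    search : ∀ k → (∀ h → HasHomPair G h → h ≤ k) → ∃ (IsH G)
    search zero    ub = 0 , ([] , [] , [] , [] , refl , refl , (λ _ ()) , ↭-refl) , ub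
    search (suc k) ub with hasHomPair? G (suc k)
    ... | yes p = suc k , p , ub
    ... | no ¬p = search k λ h p → ≤-pred (≤∧≢⇒< (ub h p) λ { refl → ¬p p })

  -- Equality of records holding functions would require function extensionality. Agreement of
  -- adjacency suffices, as distances are computed from it alone.
  _≗ᴳ_ : Graph n → Graph n → Set
  G ≗ᴳ G′ = ∀ u v → adj G u v ≡ adj G′ u v

  module _ {G G′ : Graph n} (eq : G ≗ᴳ G′) where
    reach-cong : ∀ k u v → reach G k u v ≡ reach G′ k u v
    reach-cong zero    u v = refl
    reach-cong (suc k) u v = cong₂ _∨_ (reach-cong k u v)
      (cong or (map-cong (λ w → cong₂ _∧_ (eq u w) (reach-cong k w v)) (allFin n)))

    distSearch-cong : ∀ f k u v → distSearch G f k u v ≡ distSearch G′ f k u v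
    distSearch-cong zero    k u v = refl
    distSearch-cong (suc f) k u v rewrite reach-cong k u v | distSearch-cong f (suc k) u v = refl

    hasHomPair-cong : ∀ {h} → HasHomPair G h → HasHomPair G′ h
    hasHomPair-cong (S₁ , S₂ , u₁ , u₂ , l₁ , l₂ , d , p) =
      S₁ , S₂ , u₁ , u₂ , l₁ , l₂ , d , subst₂ _↭_ (D-cong S₁) (D-cong S₂) p
      where
      D-cong : ∀ S → D G S ≡ D G′ S
      D-cong S = map-cong (λ p → distSearch-cong n 0 (proj₁ p) (proj₂ p)) (pairs S)

  -- Symmetrising and removing the diagonal turns every Boolean matrix into a graph and fixes adjacency matrices.
  symmetrise : (Fin n → Fin n → Bool) → Graph n
  symmetrise f = record
    { adj    = λ u v → (f u v ∧ f v u) ∧ not ⌊ u Fin.≟ v ⌋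
    ; sym    = λ u v → cong₂ _∧_ (∧-comm (f u v) (f v u)) (cong not (≟-sym u v))
    ; irrefl = irr
    }
    where
    ≟-sym : ∀ (u v : Fin n) → ⌊ u Fin.≟ v ⌋ ≡ ⌊ v Fin.≟ u ⌋
    ≟-sym u v with u Fin.≟ v | v Fin.≟ u
    ... | yes _ | yes _ = refl
    ... | no _  | no _  = refl
    ... | yes p | no ¬q = ⊥-elim (¬q (≡-sym p))
    ... | no ¬p | yes q = ⊥-elim (¬p (≡-sym q))
    irr : ∀ u → (f u u ∧ f u u) ∧ not ⌊ u Fin.≟ u ⌋ ≡ false
    irr u with u Fin.≟ u
    ... | yes _ = ∧-zeroʳ _
    ... | no ¬p = ⊥-elim (¬p refl)

  symmetrise-adj : ∀ G f → (∀ u v → f u v ≡ adj G u v) → G ≗ᴳ symmetrise f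
  symmetrise-adj G f eq u v with u Fin.≟ v
  ... | yes refl = trans (irrefl G u) (≡-sym (∧-zeroʳ _))
  ... | no _ rewrite eq u v | eq v u | Graph.sym G v u with adj G u v
  ...   | true  = refl
  ...   | false = refl

  -- The number of Boolean matrices; different matrices may symmetrise to the same graph.
  #graphs : ℕ
  #graphs = (2 ^ n) ^ n

  bit : Fin 2 → Bool
  bit Fin.zero       = false
  bit (Fin.suc _) = true

  unbit : Bool → Fin 2
  unbit false = Fin.zero
  unbit true  = Fin.suc Fin.zero

  bit-unbit : ∀ b → bit (unbit b) ≡ b
  bit-unbit false = refl
  bit-unbit true  = refl

  graph : Fin #graphs → Graph n
  graph c = symmetrise λ u v → bit (finToFun {2} {n} (finToFun {2 ^ n} {n} c u) v)

  graph-surjective : ∀ G → ∃ λ c → G ≗ᴳ graph c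
  graph-surjective G = funToFin row , symmetrise-adj G _ λ u v →
    trans (cong (λ c → bit (finToFun {2} {n} c v)) (Fin.finToFun-funToFin row u))
      (trans (cong bit (Fin.finToFun-funToFin (λ w → unbit (adj G u w)) v)) (bit-unbit _))
    where
    row : Fin n → Fin (2 ^ n)
    row u = funToFin λ v → unbit (adj G u v)

argmin : ∀ {k} (f : Fin k → ℕ) → Fin k → ∃ λ i → ∀ j → f i ≤ f j
argmin f i₀ = search (f i₀) i₀ ≤-refl
  where
  -- The bound `b` serves as fuel: each strictly smaller value of `f` lowers it.
  search : ∀ b i → f i ≤ b → ∃ λ i → ∀ j → f i ≤ f j
  search b i fi≤b with Fin.any? (λ j → f j <? f i)
  search b       i fi≤b | no ¬p       = i , λ j → ≮⇒≥ λ lt → ¬p (j , lt)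
  search zero    i fi≤b | yes (j , p) = ⊥-elim (n≮0 (<-≤-trans p fi≤b))
  search (suc b) i fi≤b | yes (j , p) = search b j (≤-pred (<-≤-trans p fi≤b))

isHn-exists : ∀ {n} → Graph n → ∃ (IsHn n)
isHn-exists {n} G₀ = h i , (graph i , proj₂ (isH-exists (graph i))) , lower
  where
  h : Fin (#graphs {n}) → ℕ
  h c = proj₁ (isH-exists (graph {n} c))
  -- The code of `G₀` is a starting point for `argmin`, which cannot run on an empty type.
  c₀ = proj₁ (graph-surjective G₀)
  i  = proj₁ (argmin h c₀)
  lower : ∀ (G : Graph n) h′ → IsH G h′ → h i ≤ h′
  lower G h′ (_ , max) with graph-surjective G
  ... | c , eq = ≤-trans (proj₂ (argmin h c₀) c)
    (max (h c) (hasHomPair-cong {G = graph c} {G′ = G} (λ u v → ≡-sym (eq u v)) (proj₁ (proj₂ (isH-exists (graph {n} c))))))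

-- Graphs defined by their distance function.

record IsPathMetric {n : ℕ} (d : Fin n → Fin n → ℕ) : Set where
  field
    d-sym    : ∀ u v → d u v ≡ d v u
    d-refl   : ∀ u → d u u ≡ 0
    d-zero   : ∀ u v → d u v ≡ 0 → u ≡ v
    d-step   : ∀ u w v → d u w ≡ 1 → d u v ≤ suc (d w v)
    -- `d-step` bounds `d` by the length of every walk along unit distances; `d-next` supplies a
    -- walk of exactly that length.
    d-next   : ∀ u v k → d u v ≡ suc k → ∃ λ w → d u w ≡ 1 × d w v ≡ k
    d-bound  : ∀ u v → d u v < n

module _ {n : ℕ} {d : Fin n → Fin n → ℕ} (pm : IsPathMetric d) where
  open IsPathMetric pm

  unitGraph : Graph n
  unitGraph = record
    { adj    = λ u v → d u v ≡ᵇ 1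
    ; sym    = λ u v → cong (_≡ᵇ 1) (d-sym u v)
    ; irrefl = λ u → cong (_≡ᵇ 1) (d-refl u)
    }

  reach⇒≤ : ∀ k u v → T (reach unitGraph k u v) → d u v ≤ k
  reach⇒≤ zero u v r with u Fin.≟ v
  ... | yes refl = ≤-reflexive (d-refl u)
  reach⇒≤ (suc k) u v r with Equivalence.to (T-∨ {reach unitGraph k u v}) r
  ... | inj₁ r′ = m≤n⇒m≤1+n (reach⇒≤ k u v r′)
  ... | inj₂ r′ with find (any⁻ _ (allFin n) r′)
  ...   | w , _ , e with Equivalence.to (T-∧ {d u w ≡ᵇ 1}) e
  ...     | a , r″ = ≤-trans (d-step u w v (≡ᵇ⇒≡ (d u w) 1 a)) (s≤s (reach⇒≤ k w v r″))

  ≤⇒reach : ∀ k u v → d u v ≤ k → T (reach unitGraph k u v)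
  ≤⇒reach zero u v le with u Fin.≟ v
  ... | yes _  = tt
  ... | no u≢v = u≢v (d-zero u v (n≤0⇒n≡0 le))
  ≤⇒reach (suc k) u v le with m≤n⇒m<n∨m≡n le
  ... | inj₁ lt = Equivalence.from (T-∨ {reach unitGraph k u v}) (inj₁ (≤⇒reach k u v (≤-pred lt)))
  ... | inj₂ eq with d-next u v k eq
  ...   | w , a , b = Equivalence.from (T-∨ {reach unitGraph k u v}) (inj₂ (any⁺ _ (lose (∈-allFin w)
            (Equivalence.from (T-∧ {d u w ≡ᵇ 1})
              (≡⇒≡ᵇ (d u w) 1 a , ≤⇒reach k w v (≤-reflexive b))))))

  dist-unitGraph : ∀ u v → dist unitGraph u v ≡ just (d u v)
  dist-unitGraph u v = search n 0 z≤n (d-bound u v)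
    where
    -- The search has failed below `k`, and the remaining fuel `f` still covers `d u v`.
    search : ∀ f k → k ≤ d u v → d u v < k + f → distSearch unitGraph f k u v ≡ just (d u v)
    search zero k lo hi = ⊥-elim (n≮n k (≤-trans (s≤s lo) (subst (d u v <_) (+-identityʳ k) hi)))
    search (suc f) k lo hi with reach unitGraph k u v | reach⇒≤ k u v | ≤⇒reach k u v
    ... | true  | le | _  = cong just (≤-antisym lo (le tt))
    ... | false | _  | ge = search f (suc k) (≤∧≢⇒< lo λ eq → ge (≤-reflexive (≡-sym eq)))
                                     (subst (d u v <_) (+-suc k f) hi)

-- The metric of disjoint cliques with a path attached.

∣1+n-n∣≡1 : ∀ n → ∣ suc n - n ∣ ≡ 1
∣1+n-n∣≡1 zero    = refl
∣1+n-n∣≡1 (suc n) = ∣1+n-n∣≡1 n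

∣-∣-sucˡ : ∀ {a b} → b ≤ a → ∣ suc a - b ∣ ≡ suc ∣ a - b ∣
∣-∣-sucˡ {zero}  z≤n      = refl
∣-∣-sucˡ {suc a} z≤n      = refl
∣-∣-sucˡ (s≤s le) = ∣-∣-sucˡ le

∣-∣-sucʳ : ∀ {a b} → a < b → ∣ a - b ∣ ≡ suc ∣ suc a - b ∣
∣-∣-sucʳ {zero}  (s≤s z≤n)      = refl
∣-∣-sucʳ {suc a} (s≤s lt) = ∣-∣-sucʳ lt

module Broom (N : ℕ) (blk : ℕ → ℕ) where

  -- Vertices are natural numbers: those below `N` lie in the cliques, and `N + k` is the path
  -- vertex number `k`. `depth` is the distance to the union of the cliques.
  depth : ℕ → ℕ
  depth x = suc x ∸ N

  -- Different cliques are connected through the first path vertex, whence the distance 2.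
  hd : ℕ → ℕ → ℕ
  hd x y with x ≟ y | blk x ≟ blk y
  ... | yes _ | _     = 0
  ... | no _  | yes _ = 1
  ... | no _  | no _  = 2

  pathDist : ℕ → ℕ → ℕ → ℕ → ℕ
  pathDist zero    zero    x y = hd x y
  pathDist zero    (suc q) _ _ = suc q
  pathDist (suc p) zero    _ _ = suc p
  pathDist (suc p) (suc q) _ _ = ∣ p - q ∣

  d : ℕ → ℕ → ℕ
  d x y = pathDist (depth x) (depth y) x y

  hd-refl : ∀ x → hd x x ≡ 0
  hd-refl x with x ≟ x
  ... | yes _ = refl
  ... | no ¬p = ⊥-elim (¬p refl)

  hd-sym : ∀ x y → hd x y ≡ hd y x
  hd-sym x y with x ≟ y | y ≟ x | blk x ≟ blk y | blk y ≟ blk x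
  ... | yes _ | yes _ | _     | _     = refl
  ... | yes p | no ¬q | _     | _     = ⊥-elim (¬q (≡-sym p))
  ... | no ¬p | yes q | _     | _     = ⊥-elim (¬p (≡-sym q))
  ... | no _  | no _  | yes _ | yes _ = refl
  ... | no _  | no _  | no _  | no _  = refl
  ... | no _  | no _  | yes p | no ¬q = ⊥-elim (¬q (≡-sym p))
  ... | no _  | no _  | no ¬p | yes q = ⊥-elim (¬p (≡-sym q))

  hd-zero : ∀ x y → hd x y ≡ 0 → x ≡ y
  hd-zero x y eq with x ≟ y | blk x ≟ blk y
  ... | yes p | _ = p
  hd-zero x y () | no _ | yes _
  hd-zero x y () | no _ | no _

  hd≤2 : ∀ x y → hd x y ≤ 2
  hd≤2 x y with x ≟ y | blk x ≟ blk y
  ... | yes _ | _     = z≤n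
  ... | no _  | yes _ = s≤s z≤n
  ... | no _  | no _  = ≤-refl

  d-clique : ∀ {x y} → depth x ≡ 0 → depth y ≡ 0 → d x y ≡ hd x y
  d-clique ex ey rewrite ex | ey = refl

  -- Away from pairs of clique vertices the metric is that of a line with coordinate `depth`.
  d-path : ∀ x y → (depth x ≡ 0 × depth y ≡ 0) ⊎ (d x y ≡ ∣ depth x - depth y ∣)
  d-path x y with depth x | depth y
  ... | zero  | zero  = inj₁ (refl , refl)
  ... | zero  | suc _ = inj₂ refl
  ... | suc _ | zero  = inj₂ refl
  ... | suc _ | suc _ = inj₂ refl

  d-path⁺ : ∀ {x y k} → depth x ≡ suc k → d x y ≡ ∣ depth x - depth y ∣
  d-path⁺ {x} {y} e with d-path x y
  ... | inj₂ eq       = eq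
  ... | inj₁ (e₀ , _) with () ← trans (≡-sym e) e₀

  ∣depth∣≤d : ∀ x y → ∣ depth x - depth y ∣ ≤ d x y
  ∣depth∣≤d x y with d-path x y
  ... | inj₂ eq = ≤-reflexive (≡-sym eq)
  ... | inj₁ (ex , ey) rewrite ex | ey = z≤n

  depth-suc : ∀ {x k} → depth x ≡ suc k → x ≡ N + k
  depth-suc {x} {k} e = suc-injective (trans (≡-sym (m+[n∸m]≡n N≤)) (trans (cong (N +_) e) (+-suc N k)))
    where
    N≤ : N ≤ suc x
    N≤ with N ≤? suc x
    ... | yes p = p
    ... | no ¬p with () ← trans (≡-sym e) (m≤n⇒m∸n≡0 (<⇒≤ (≰⇒> ¬p)))

  depth-N+ : ∀ k → depth (N + k) ≡ suc k
  depth-N+ k = trans (cong (_∸ N) (≡-sym (+-suc N k))) (m+n∸m≡n N (suc k))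

  depth≡0⇒< : ∀ {x} → depth x ≡ 0 → x < N
  depth≡0⇒< = m∸n≡0⇒m≤n

  d-sym : ∀ x y → d x y ≡ d y x
  d-sym x y with depth x | depth y
  ... | zero  | zero  = hd-sym x y
  ... | zero  | suc _ = refl
  ... | suc _ | zero  = refl
  ... | suc p | suc q = ∣-∣-comm p q

  d-refl : ∀ x → d x x ≡ 0
  d-refl x with depth x
  ... | zero  = hd-refl x
  ... | suc p = ∣n-n∣≡0 p

  d-zero : ∀ x y → d x y ≡ 0 → x ≡ y
  d-zero x y eq with depth x in ex | depth y in ey
  ... | zero  | zero  = hd-zero x y eq
  ... | suc p | suc q = trans (depth-suc ex) (trans (cong (N +_) (∣m-n∣≡0⇒m≡n eq)) (≡-sym (depth-suc ey)))
  d-zero x y () | zero  | suc _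
  d-zero x y () | suc _ | zero

  -- As `depth` never changes by more than the distance, the triangle inequality of the line
  -- suffices unless both ends are clique vertices. Then the distance is at most 2, and only `z = y`
  -- needs separate care.
  d-step : ∀ x z y → d x z ≡ 1 → d x y ≤ suc (d z y)
  d-step x z y e with d-path x y
  ... | inj₂ eq = begin
    d x y                                              ≡⟨ eq ⟩
    ∣ depth x - depth y ∣                              ≤⟨ ∣-∣-triangle (depth x) (depth z) (depth y) ⟩
    ∣ depth x - depth z ∣ + ∣ depth z - depth y ∣      ≤⟨ +-mono-≤ (∣depth∣≤d x z) (∣depth∣≤d z y) ⟩
    d x z + d z y                                      ≡⟨ cong (_+ d z y) e ⟩
    suc (d z y)                                        ∎
    where open ≤-Reasoning
  ... | inj₁ (ex , ey) with d z y in ez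
  ...   | zero with refl ← d-zero z y ez = ≤-reflexive e
  ...   | suc k = ≤-trans (≤-reflexive (d-clique ex ey)) (≤-trans (hd≤2 x y) (s≤s (s≤s z≤n)))

  depth-view : ∀ x → depth x ≡ 0 ⊎ ∃ λ p → depth x ≡ suc p
  depth-view x with depth x
  ... | zero  = inj₁ refl
  ... | suc p = inj₂ (p , refl)

  depth≤ : ∀ {m x} → x < N + m → depth x ≤ m
  depth≤ lt = m≤n+o⇒m∸n≤o _ N lt

  module _ {m : ℕ} (1≤N : 1 ≤ N) (2≤m : 2 ≤ m) where

    d-bound : ∀ {x y} → x < N + m → y < N + m → d x y < N + m
    d-bound {x} {y} lx ly with d-path x y
    ... | inj₁ (ex , ey) = ≤-trans (s≤s (≤-trans (≤-reflexive (d-clique ex ey)) (hd≤2 x y))) (+-mono-≤ 1≤N 2≤m)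
    ... | inj₂ eq = ≤-trans (s≤s (≤-trans (≤-reflexive eq) (≤-trans (∣m-n∣≤m⊔n (depth x) (depth y)) (⊔-lub (depth≤ lx) (depth≤ ly)))))
                            (+-mono-≤ 1≤N ≤-refl)

    d-next : ∀ {x y k} → x < N + m → y < N + m → d x y ≡ suc k →
             ∃ λ w → w < N + m × d x w ≡ 1 × d w y ≡ k
    d-next {x} {y} {zero}  lx ly e = y , ly , e , d-refl y
    d-next {x} {y} {suc k} lx ly e with depth-view x
    -- From a clique vertex, any target at distance 2 or more is reached through the first path
    -- vertex, be it in another clique or on the path.
    ... | inj₁ ex = N + 0 , +-monoʳ-< N (≤-trans (s≤s z≤n) 2≤m) , toFirst , fromFirst (depth-view y)
      where
      toFirst : d x (N + 0) ≡ 1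
      toFirst rewrite ex | depth-N+ 0 = refl
      fromFirst : depth y ≡ 0 ⊎ (∃ λ q → depth y ≡ suc q) → d (N + 0) y ≡ suc k
      fromFirst (inj₁ ey) = trans (d-path⁺ (depth-N+ 0)) (trans (cong₂ ∣_-_∣ (depth-N+ 0) ey)
        (≤-antisym (s≤s z≤n) (≤-pred (subst (_≤ 2) (trans (≡-sym (d-clique ex ey)) e) (hd≤2 x y)))))
      fromFirst (inj₂ (q , ey)) rewrite ex | ey | depth-N+ 0 = suc-injective e
    ... | inj₂ (p , ex) with depth y ≤? p
    ...   | yes le = closer p ex le
      where
      closer : ∀ p → depth x ≡ suc p → depth y ≤ p → _
      -- Here `x` is the first path vertex and `y` a clique vertex, so their distance is 1 and not
      -- at least 2.
      closer zero ex le = ⊥-elim (1+n≢0 (suc-injective (trans (≡-sym e) (trans (d-path⁺ ex) (cong₂ ∣_-_∣ ex (n≤0⇒n≡0 le))))))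
      closer (suc p) ex le = N + p , ≤-trans (s≤s (≤-trans (+-monoʳ-≤ N (n≤1+n p)) (≤-reflexive (≡-sym (depth-suc ex))))) lx ,
        trans (d-path⁺ ex) (trans (cong₂ ∣_-_∣ ex (depth-N+ p)) (∣1+n-n∣≡1 p)) ,
        trans (d-path⁺ (depth-N+ p)) (trans (cong (∣_- depth y ∣) (depth-N+ p)) (suc-injective
          (trans (≡-sym (∣-∣-sucˡ le)) (trans (cong (∣_- depth y ∣) (≡-sym ex)) (trans (≡-sym (d-path⁺ ex)) e)))))
    ...   | no ¬le with m≤n⇒m<n∨m≡n (≰⇒> ¬le)
    ...     | inj₂ eq = ⊥-elim (1+n≢0 (trans (≡-sym e) (trans (d-path⁺ ex) (trans (cong₂ ∣_-_∣ ex (≡-sym eq)) (∣n-n∣≡0 (suc p))))))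
    ...     | inj₁ lt = N + suc p , +-monoʳ-< N (≤-trans lt (depth≤ ly)) ,
        trans (d-path⁺ ex) (trans (cong₂ ∣_-_∣ ex (depth-N+ (suc p))) (trans (∣-∣-comm (suc p) (suc (suc p))) (∣1+n-n∣≡1 (suc p)))) ,
        trans (d-path⁺ (depth-N+ (suc p))) (trans (cong (∣_- depth y ∣) (depth-N+ (suc p))) (suc-injective
          (trans (≡-sym (∣-∣-sucʳ lt)) (trans (cong (∣_- depth y ∣) (≡-sym ex)) (trans (≡-sym (d-path⁺ ex)) e)))))

    dFin : Fin (N + m) → Fin (N + m) → ℕ
    dFin u v = d (toℕ u) (toℕ v)

    dFin-pathMetric : IsPathMetric dFin
    dFin-pathMetric = record
      { d-sym   = λ u v → d-sym (toℕ u) (toℕ v)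
      ; d-refl  = λ u → d-refl (toℕ u)
      ; d-zero  = λ u v e → Fin.toℕ-injective (d-zero (toℕ u) (toℕ v) e)
      ; d-step  = λ u w v → d-step (toℕ u) (toℕ w) (toℕ v)
      ; d-next  = λ u v k e → next u v (d-next (Fin.toℕ<n u) (Fin.toℕ<n v) e)
      ; d-bound = λ u v → d-bound (Fin.toℕ<n u) (Fin.toℕ<n v)
      }
      where
      next : ∀ u v {k} → (∃ λ w → w < N + m × d (toℕ u) w ≡ 1 × d w (toℕ v) ≡ k) →
             ∃ λ w → dFin u w ≡ 1 × dFin w v ≡ k
      next u v (w , lw , a , b) = fromℕ< lw ,
        trans (cong (d (toℕ u)) (Fin.toℕ-fromℕ< lw)) a , trans (cong (λ z → d z (toℕ v)) (Fin.toℕ-fromℕ< lw)) b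

    broom : Graph (N + m)
    broom = unitGraph dFin-pathMetric

-- Distance lists up to permutation.

module _ {A B : Set} where

  pairwise : (A → A → B) → List A → List B
  pairwise f []       = []
  pairwise f (x ∷ xs) = map (f x) xs ++ pairwise f xs

  pairs-pairwise : ∀ f xs → map (λ p → f (proj₁ p) (proj₂ p)) (pairs xs) ≡ pairwise f xs
  pairs-pairwise f []       = refl
  pairs-pairwise f (x ∷ xs) = trans (map-++ _ (map (x ,_) xs) (pairs xs))
    (cong₂ _++_ (≡-sym (map-∘ xs)) (pairs-pairwise f xs))

  -- This allows distinguished vertices to be moved to the front of a set. In the `swap` case the
  -- rows of `x` and `y` trade places behind their common entry.
  pairwise-↭ : ∀ {f} → (∀ x y → f x y ≡ f y x) → ∀ {xs ys} → xs ↭ ys → pairwise f xs ↭ pairwise f ys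
  pairwise-↭ f-sym refl       = refl
  pairwise-↭ f-sym (prep x p) = Perm.++⁺ (Perm.map⁺ _ p) (pairwise-↭ f-sym p)
  pairwise-↭ {f} f-sym (swap {xs} {ys} x y p) rewrite f-sym x y =
    prep _ (↭-trans (Perm.++⁺ (Perm.map⁺ (f x) p) (Perm.++⁺ (Perm.map⁺ (f y) p) (pairwise-↭ f-sym p))) (exchange (map (f x) ys) (map (f y) ys)))
    where
    exchange : ∀ as bs {cs : List B} → as ++ bs ++ cs ↭ bs ++ as ++ cs
    exchange []       bs = refl
    exchange (a ∷ as) bs = ↭-trans (prep a (exchange as bs)) (↭-sym (shift a bs _))
  pairwise-↭ f-sym (_↭_.trans p q) = ↭-trans (pairwise-↭ f-sym p) (pairwise-↭ f-sym q)

  All-pairwise : ∀ {f} {P : B → Set} {xs} → (∀ {x y} → x ∈ xs → y ∈ xs → P (f x y)) → All P (pairwise f xs)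
  All-pairwise {f} {P} {[]}     h = []
  All-pairwise {f} {P} {x ∷ xs} h =
    All.++⁺ (All.map⁺ (All.tabulate λ y∈ → h (here refl) (there y∈)))
            (All-pairwise λ x∈ y∈ → h (there x∈) (there y∈))

pairwise-map : ∀ {A B C : Set} (g : C → A) (f : A → A → B) xs → pairwise f (map g xs) ≡ pairwise (λ x y → f (g x) (g y)) xs
pairwise-map g f []       = refl
pairwise-map g f (x ∷ xs) = cong₂ _++_ (≡-sym (map-∘ xs)) (pairwise-map g f xs)

extract : {A : Set} {x : A} {xs : List A} → x ∈ xs → ∃ λ ys → xs ↭ x ∷ ys
extract {x = x} x∈ with ∈-∃++ x∈
... | as , bs , refl = as ++ bs , shift x as bs

extract₂ : {A : Set} {x y : A} {xs : List A} → x ∈ xs → y ∈ xs → x ≢ y → ∃ λ zs → xs ↭ x ∷ y ∷ zs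
extract₂ {x = x} x∈ y∈ x≢y with extract x∈
... | ys , p with ∈-resp-↭ p y∈
...   | here y≡x  = ⊥-elim (x≢y (≡-sym y≡x))
...   | there y∈′ with extract y∈′
...     | zs , q = zs , ↭-trans p (prep x q)

extract₃ : {A : Set} {x y z : A} {xs : List A} → x ∈ xs → y ∈ xs → z ∈ xs →
           x ≢ y → x ≢ z → y ≢ z → ∃ λ zs → xs ↭ x ∷ y ∷ z ∷ zs
extract₃ {x = x} x∈ y∈ z∈ x≢y x≢z y≢z with extract x∈
... | ys , p with ∈-resp-↭ p y∈ | ∈-resp-↭ p z∈
...   | here y≡x  | _         = ⊥-elim (x≢y (≡-sym y≡x))
...   | there _   | here z≡x  = ⊥-elim (x≢z (≡-sym z≡x))
...   | there y∈′ | there z∈′ with extract₂ y∈′ z∈′ y≢z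
...     | zs , q = zs , ↭-trans p (prep x q)

∈-pairwise⁺ : {A B : Set} {f : A → A → B} → (∀ x y → f x y ≡ f y x) → ∀ {x y xs} →
              x ∈ xs → y ∈ xs → x ≢ y → f x y ∈ pairwise f xs
∈-pairwise⁺ f-sym x∈ y∈ x≢y = ∈-resp-↭ (↭-sym (pairwise-↭ f-sym (proj₂ (extract₂ x∈ y∈ x≢y)))) (here refl)

∈-pairwise⁻ : {A B : Set} {f : A → A → B} → ∀ {v} xs →
              v ∈ pairwise f xs → ∃₂ λ x y → ∃ λ zs → xs ↭ x ∷ y ∷ zs × v ≡ f x y
∈-pairwise⁻ {f = f} (x ∷ xs) v∈ with ∈-++⁻ (map (f x) xs) v∈
... | inj₁ v∈ˡ with ∈-map⁻ (f x) v∈ˡ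
...   | y , y∈ , eq with extract y∈
...     | zs , p = x , y , zs , prep x p , eq
∈-pairwise⁻ {f = f} (x ∷ xs) v∈ | inj₂ v∈ʳ with ∈-pairwise⁻ xs v∈ʳ
... | y , z , zs , p , eq = y , z , x ∷ zs ,
      ↭-trans (prep x p) (↭-trans (swap x y refl) (prep y (swap x z refl))) , eq

Unique-resp-↭ : {A : Set} {xs ys : List A} → xs ↭ ys → Unique xs → Unique ys
Unique-resp-↭ p = Permₛ.Unique-resp-↭ (≡.setoid _) (↭⇒↭ₛ p)

unique-interval : ∀ {a k} {xs : List ℕ} → Unique xs → All (λ x → a ≤ x × x < a + k) xs → length xs ≤ k
unique-interval {a} {k} {xs} u all = ≮⇒≥ λ lt → clash (Fin.pigeonhole lt position)
  where
  offset< : ∀ i → lookup xs i ∸ a < k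
  offset< i with lo , hi ← All.lookup all (∈-lookup i) =
    ≤-trans (≤-reflexive (≡-sym (+-∸-assoc 1 lo))) (m≤n+o⇒m∸n≤o _ a hi)
  position : Fin (length xs) → Fin k
  position i = fromℕ< (offset< i)
  clash : ¬ (∃₂ λ i j → i Fin.< j × position i ≡ position j)
  clash (i , j , i<j , eq) = unique⇒lookup-injective u i<j
    (∸-cancelʳ-≡ (proj₁ (All.lookup all (∈-lookup i))) (proj₁ (All.lookup all (∈-lookup j)))
      (Fin.fromℕ<-injective _ _ (offset< i) (offset< j) eq))

-- Counting vertices and edges by class.

δ : ℕ → ℕ → ℕ
δ a b with a ≟ b
... | yes _ = 1
... | no _  = 0

δ-≡ : ∀ a → δ a a ≡ 1
δ-≡ a with a ≟ a
... | yes _  = refl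
... | no a≢a = ⊥-elim (a≢a refl)

δ-≢ : ∀ {a b} → a ≢ b → δ a b ≡ 0
δ-≢ {a} {b} a≢b with a ≟ b
... | yes a≡b = ⊥-elim (a≢b a≡b)
... | no _    = refl

occ : ℕ → List ℕ → ℕ
occ j []       = 0
occ j (x ∷ xs) = δ x j + occ j xs

occ-++ : ∀ j xs ys → occ j (xs ++ ys) ≡ occ j xs + occ j ys
occ-++ j []       ys = refl
occ-++ j (x ∷ xs) ys = trans (cong (δ x j +_) (occ-++ j xs ys)) (≡-sym (+-assoc (δ x j) _ _))

sumTo : ℕ → (ℕ → ℕ) → ℕ
sumTo zero    f = 0
sumTo (suc i) f = sumTo i f + f i

sumTo-cong : ∀ i {f g} → (∀ j → j < i → f j ≡ g j) → sumTo i f ≡ sumTo i g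
sumTo-cong zero    h = refl
sumTo-cong (suc i) h = cong₂ _+_ (sumTo-cong i λ j lt → h j (m<n⇒m<1+n lt)) (h i ≤-refl)

sumTo-+ : ∀ i f g → sumTo i (λ j → f j + g j) ≡ sumTo i f + sumTo i g
sumTo-+ zero    f g = refl
sumTo-+ (suc i) f g rewrite sumTo-+ i f g = +-interchange (sumTo i f) (sumTo i g) (f i) (g i)

sumTo-mono : ∀ i {f g} → (∀ j → j < i → f j ≤ g j) → sumTo i f ≤ sumTo i g
sumTo-mono zero    h = z≤n
sumTo-mono (suc i) h = +-mono-≤ (sumTo-mono i λ j lt → h j (m<n⇒m<1+n lt)) (h i ≤-refl)

sumTo-0 : ∀ i → sumTo i (λ _ → 0) ≡ 0
sumTo-0 zero    = refl
sumTo-0 (suc i) = trans (+-identityʳ _) (sumTo-0 i)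

sumTo-1 : ∀ i → sumTo i (λ _ → 1) ≡ i
sumTo-1 zero    = refl
sumTo-1 (suc i) = trans (cong (_+ 1) (sumTo-1 i)) (+-comm i 1)

sumTo-update : ∀ i {f g} a e → a < i → f a ≡ g a + e → (∀ j → j ≢ a → f j ≡ g j) → sumTo i f ≡ sumTo i g + e
sumTo-update (suc i) {f} {g} a e a<i at off with a ≟ i
... | yes refl = trans (cong₂ _+_ (sumTo-cong i λ j lt → off j (<⇒≢ lt)) at) (≡-sym (+-assoc (sumTo i g) (g i) e))
... | no a≢i   = trans (cong₂ _+_ (sumTo-update i a e (≤∧≢⇒< (≤-pred a<i) a≢i) at off) (off i λ eq → a≢i (≡-sym eq)))
                       (shuffle (sumTo i g) e (g i))
  where
  shuffle : ∀ a b c → (a + b) + c ≡ (a + c) + b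
  shuffle = solve-∀

sumTo-δ : ∀ {i a} → a < i → sumTo i (δ a) ≡ 1
sumTo-δ {i} {a} a<i = trans (sumTo-update i {δ a} {λ _ → 0} a 1 a<i (δ-≡ a) λ j j≢a → δ-≢ λ eq → j≢a (≡-sym eq))
                            (cong (_+ 1) (sumTo-0 i))

sumTo-δ≥ : ∀ {i a} → i ≤ a → sumTo i (δ a) ≡ 0
sumTo-δ≥ {i} {a} i≤a = trans (sumTo-cong i λ j lt → δ-≢ (>⇒≢ (<-≤-trans lt i≤a))) (sumTo-0 i)

-- The binomial coefficient C(c, 2), the number of edges of a clique on `c` vertices.
tri : ℕ → ℕ
tri zero    = 0
tri (suc c) = tri c + c

total : ℕ → List ℕ → ℕ
total r cs = sumTo r (λ j → occ j cs)

total-cons< : ∀ {r a} cs → a < r → total r (a ∷ cs) ≡ suc (total r cs)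
total-cons< {r} {a} cs a<r = trans (sumTo-+ r (δ a) (λ j → occ j cs)) (cong (_+ total r cs) (sumTo-δ a<r))

total-cons≥ : ∀ {r a} cs → r ≤ a → total r (a ∷ cs) ≡ total r cs
total-cons≥ {r} {a} cs r≤a = trans (sumTo-+ r (δ a) (λ j → occ j cs)) (cong (_+ total r cs) (sumTo-δ≥ r≤a))

-- The number of pairs at distance 1 in a set with occ j elements in clique j < r, where class r is the
-- first and class r + 1 the second vertex of the path.
edges : ℕ → List ℕ → ℕ
edges r cs = sumTo r (λ j → tri (occ j cs)) + occ r cs * (total r cs + occ (suc r) cs)

-- This and the next two lemmas mirror adjacency. A clique vertex is joined to its own clique and
-- the first path vertex, the first path vertex to all cliques and the second path vertex, and the
-- second path vertex to the first.
edges-clique : ∀ {r a} cs → a < r → edges r (a ∷ cs) ≡ (occ a cs + occ r cs) + edges r cs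
edges-clique {r} {a} cs a<r
  rewrite total-cons< cs a<r | δ-≢ (<⇒≢ a<r) | δ-≢ (<⇒≢ (m<n⇒m<1+n a<r))
        | sumTo-update r {λ j → tri (occ j (a ∷ cs))} {λ j → tri (occ j cs)} a (occ a cs) a<r
            (cong (λ e → tri (e + occ a cs)) (δ-≡ a)) (λ j j≢a → cong (λ e → tri (e + occ j cs)) (δ-≢ λ eq → j≢a (≡-sym eq)))
  = shuffle (sumTo r (λ j → tri (occ j cs))) (occ a cs) (occ r cs) (total r cs + occ (suc r) cs)
  where
  shuffle : ∀ E o x t → E + o + x * suc t ≡ (o + x) + (E + x * t)
  shuffle = solve-∀

edges-first : ∀ r cs → edges r (r ∷ cs) ≡ (total r cs + occ (suc r) cs) + edges r cs
edges-first r cs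
  rewrite total-cons≥ {r} cs ≤-refl | δ-≡ r | δ-≢ (<⇒≢ (n<1+n r))
        | sumTo-cong r {λ j → tri (occ j (r ∷ cs))} {λ j → tri (occ j cs)} (λ j lt → cong (λ e → tri (e + occ j cs)) (δ-≢ (>⇒≢ lt)))
  = shuffle (sumTo r (λ j → tri (occ j cs))) (occ r cs) (total r cs + occ (suc r) cs)
  where
  shuffle : ∀ E x t → E + suc x * t ≡ t + (E + x * t)
  shuffle = solve-∀

edges-second : ∀ r cs → edges r (suc r ∷ cs) ≡ occ r cs + edges r cs
edges-second r cs
  rewrite total-cons≥ {r} cs (n≤1+n r) | δ-≡ (suc r) | δ-≢ (>⇒≢ (n<1+n r))
        | sumTo-cong r {λ j → tri (occ j (suc r ∷ cs))} {λ j → tri (occ j cs)} (λ j lt → cong (λ e → tri (e + occ j cs)) (δ-≢ (>⇒≢ (m<n⇒m<1+n lt))))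
  = shuffle (sumTo r (λ j → tri (occ j cs))) (occ r cs) (total r cs) (occ (suc r) cs)
  where
  shuffle : ∀ E x t s → E + x * (t + suc s) ≡ x + (E + x * (t + s))
  shuffle = solve-∀

length-total : ∀ {r} cs → All (_≤ suc r) cs → length cs ≡ total r cs + occ r cs + occ (suc r) cs
length-total {r} []       []         = ≡-sym (trans (+-identityʳ _) (trans (+-identityʳ _) (sumTo-0 r)))
length-total {r} (a ∷ cs) (a≤ ∷ cs≤) with <-cmp a r
... | tri< a<r _ _ rewrite total-cons< cs a<r | δ-≢ (<⇒≢ a<r) | δ-≢ (<⇒≢ (m<n⇒m<1+n a<r)) = cong suc (length-total cs cs≤)
... | tri≈ _ refl _ rewrite total-cons≥ {r} cs ≤-refl | δ-≡ r | δ-≢ (<⇒≢ (n<1+n r)) | length-total cs cs≤ = shuffle (total r cs) (occ r cs) _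
  where
  shuffle : ∀ a b c → suc (a + b + c) ≡ a + suc b + c
  shuffle = solve-∀
... | tri> _ _ r<a with refl ← ≤-antisym a≤ r<a
  rewrite total-cons≥ {r} cs (n≤1+n r) | δ-≡ (suc r) | δ-≢ (>⇒≢ (n<1+n r)) | length-total cs cs≤
  = ≡-sym (+-suc _ _)

-- A vertex joined to a clique enlarges it by one, so the first path vertex, if present, can be
-- absorbed into every clique at once.
tri-shift : ∀ r cs x → x ≤ 1 → sumTo r (λ j → tri (occ j cs)) + x * total r cs ≡ sumTo r (λ j → tri (x + occ j cs))
tri-shift r cs zero    _ = +-identityʳ _
tri-shift r cs (suc zero) _ = trans (cong (sumTo r (λ j → tri (occ j cs)) +_) (+-identityʳ _)) (≡-sym (sumTo-+ r (λ j → tri (occ j cs)) (λ j → occ j cs)))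
tri-shift r cs (suc (suc _)) (s≤s ())

tri-mono : ∀ {a b} → a ≤ b → tri a ≤ tri b
tri-mono z≤n       = z≤n
tri-mono (s≤s a≤b) = +-mono-≤ (tri-mono a≤b) a≤b

tri-suc≤sq : ∀ c → tri (suc c) ≤ c * c
tri-suc≤sq zero    = z≤n
tri-suc≤sq (suc c) = ≤-trans (+-monoˡ-≤ (suc c) (tri-suc≤sq c))
  (subst (c * c + suc c ≤_) (expand c) (m≤m+n _ c))
  where
  expand : ∀ c → c * c + suc c + c ≡ suc c * suc c
  expand = solve-∀

-- The last step of `tri` up to `e` already adds `e - 1`, so `e - 1`, and with it `d`, is at most
-- `b`.
tri-gap : ∀ {d e b} → d < e → tri e ≤ tri d + b → d + e ≤ suc (2 * b)
tri-gap {d} {suc e} {b} (s≤s d≤e) le = ≤-trans (+-mono-≤ (≤-trans d≤e e≤b) (s≤s e≤b)) (≤-reflexive (double b))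
  where
  double : ∀ b → b + suc b ≡ suc (2 * b)
  double = solve-∀
  e≤b : e ≤ b
  e≤b = +-cancelˡ-≤ (tri d) e b (≤-trans (+-monoˡ-≤ e (tri-mono d≤e)) le)

-- Clique sizes and the comparison of edge counts.

module Cascade (R : ℕ) where

  -- The size of the clique that follows `ℓ` vertices in smaller ones. Their edges, even with the
  -- first path vertex absorbed, number at most `ℓ * ℓ`, which the quadratic term outweighs. The
  -- rest leaves room for `R` missing vertices and makes the size odd.
  width : ℕ → ℕ
  width ℓ = 2 * (ℓ * ℓ) + (2 * R + 7)

  level : ℕ → ℕ
  level zero    = 0
  level (suc j) = level j + width (level j)

  size : ℕ → ℕ
  size j = width (level j)

  level-sum : ∀ i → sumTo i size ≡ level i
  level-sum zero    = refl
  level-sum (suc i) = cong (_+ size i) (level-sum i)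

  -- Each summand is at most the square of the clique size, and the sum of the squares is at most
  -- the square of the sum.
  sumTo-tri≤ : ∀ i (c : ℕ → ℕ) {x} → x ≤ 1 → (∀ j → j < i → c j ≤ size j) → sumTo i (λ j → tri (x + c j)) ≤ level i * level i
  sumTo-tri≤ zero    c x≤1 h = z≤n
  sumTo-tri≤ (suc i) c {x} x≤1 h = begin
    sumTo i (λ j → tri (x + c j)) + tri (x + c i)  ≤⟨ +-mono-≤ (sumTo-tri≤ i c x≤1 λ j lt → h j (m<n⇒m<1+n lt))
                                                        (≤-trans (tri-mono (+-mono-≤ x≤1 (h i ≤-refl))) (tri-suc≤sq (size i))) ⟩
    level i * level i + size i * size i            ≤⟨ m≤m+n _ (2 * (level i * size i)) ⟩
    level i * level i + size i * size i + 2 * (level i * size i) ≡⟨ square (level i) (size i) ⟩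
    level (suc i) * level (suc i)                  ∎
    where
    open ≤-Reasoning
    square : ∀ a b → a * a + b * b + 2 * (a * b) ≡ (a + b) * (a + b)
    square = solve-∀

  few : ∀ i a b s t → s + t ≤ level i → a + b ≤ suc (2 * suc (level i * level i)) → s + a + (t + b) + R ≤ level (suc i)
  few i a b s t st ab = begin
    s + a + (t + b) + R                      ≡⟨ shuffle s a t b R ⟩
    (s + t) + (a + b + R)                    ≤⟨ +-mono-≤ st (+-monoˡ-≤ R ab) ⟩
    -- The size of the clique exceeds the required amount by exactly `R + 4`.
    level i + (suc (2 * suc (level i * level i)) + R) ≤⟨ +-monoʳ-≤ (level i) (m≤m+n _ (R + 4)) ⟩
    level i + (suc (2 * suc (level i * level i)) + R + (R + 4)) ≡⟨ cong (level i +_) (widen (level i * level i) R) ⟩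
    level (suc i)                            ∎
    where
    open ≤-Reasoning
    shuffle : ∀ s a t b r → s + a + (t + b) + r ≡ (s + t) + (a + b + r)
    shuffle = solve-∀
    widen : ∀ q r → suc (2 * suc q) + r + (r + 4) ≡ 2 * q + (2 * r + 7)
    widen = solve-∀

  -- A clique has more than twice as many vertices as there are pairs in all smaller ones.
  lopsided : ∀ i (c₁ c₂ : ℕ → ℕ) {x₁ x₂} → x₁ ≤ 1 → (∀ j → j < suc i → c₁ j + c₂ j ≤ size j) →
             sumTo (suc i) (λ j → tri (x₂ + c₂ j)) ≤ suc (sumTo (suc i) (λ j → tri (x₁ + c₁ j))) →
             x₁ + c₁ i < x₂ + c₂ i → sumTo (suc i) c₁ + sumTo (suc i) c₂ + R ≤ level (suc i)
  lopsided i c₁ c₂ {x₁} {x₂} x₁≤1 cap le lt =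
    few i (c₁ i) (c₂ i) (sumTo i c₁) (sumTo i c₂) used
      (≤-trans (+-mono-≤ (m≤n+m (c₁ i) x₁) (m≤n+m (c₂ i) x₂))
        (tri-gap lt (gap (sumTo-tri≤ i c₁ x₁≤1 λ j j<i → m+n≤o⇒m≤o (c₁ j) (cap j (m<n⇒m<1+n j<i))))))
    where
    used : sumTo i c₁ + sumTo i c₂ ≤ level i
    used = begin
      sumTo i c₁ + sumTo i c₂       ≡⟨ sumTo-+ i c₁ c₂ ⟨
      sumTo i (λ j → c₁ j + c₂ j)   ≤⟨ sumTo-mono i (λ j j<i → cap j (m<n⇒m<1+n j<i)) ⟩
      sumTo i size                  ≡⟨ level-sum i ⟩
      level i                       ∎
      where open ≤-Reasoning
    s₁ = sumTo i (λ j → tri (x₁ + c₁ j))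
    t₁ = tri (x₁ + c₁ i)
    gap : s₁ ≤ level i * level i → tri (x₂ + c₂ i) ≤ t₁ + suc (level i * level i)
    gap s₁≤ = begin
      tri (x₂ + c₂ i)                ≤⟨ m≤n+m _ _ ⟩
      sumTo (suc i) (λ j → tri (x₂ + c₂ j)) ≤⟨ le ⟩
      suc (s₁ + t₁)                  ≤⟨ s≤s (+-monoˡ-≤ t₁ s₁≤) ⟩
      suc (level i * level i + t₁)   ≡⟨ +-comm (suc (level i * level i)) t₁ ⟩
      t₁ + suc (level i * level i)   ∎
      where open ≤-Reasoning

  -- Induction from the largest clique down. Equal counts cancel and leave the tolerance of 1 intact
  -- for the smaller cliques; the first unequal counts are settled by `lopsided`.
  cascade : ∀ i (c₁ c₂ : ℕ → ℕ) {x₁ x₂} → x₁ ≤ 1 → x₂ ≤ 1 → (∀ j → j < i → c₁ j + c₂ j ≤ size j) →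
            sumTo i (λ j → tri (x₁ + c₁ j)) ≤ suc (sumTo i (λ j → tri (x₂ + c₂ j))) →
            sumTo i (λ j → tri (x₂ + c₂ j)) ≤ suc (sumTo i (λ j → tri (x₁ + c₁ j))) →
            (∀ j → j < i → x₁ + c₁ j ≡ x₂ + c₂ j) ⊎ (sumTo i c₁ + sumTo i c₂ + R ≤ level i)
  cascade zero    c₁ c₂ _ _ _ _ _ = inj₁ λ _ ()
  cascade (suc i) c₁ c₂ {x₁} {x₂} x₁≤1 x₂≤1 cap le₁ le₂ with <-cmp (x₁ + c₁ i) (x₂ + c₂ i)
  ... | tri< lt _ _ = inj₂ (lopsided i c₁ c₂ x₁≤1 cap le₂ lt)
  ... | tri> _ _ gt = inj₂ (subst (λ s → s + R ≤ level (suc i)) (+-comm (sumTo (suc i) c₂) (sumTo (suc i) c₁))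
                             (lopsided i c₂ c₁ x₂≤1 (λ j lt → subst (_≤ size j) (+-comm (c₁ j) (c₂ j)) (cap j lt)) le₁ gt))
  ... | tri≈ _ eq _ with cascade i c₁ c₂ x₁≤1 x₂≤1 (λ j lt → cap j (m<n⇒m<1+n lt))
                          (cancel {x₁ = x₁ + c₁ i} eq le₁) (cancel {x₁ = x₂ + c₂ i} (≡-sym eq) le₂)
    where
    cancel : ∀ {s t x₁ x₂} → x₁ ≡ x₂ → s + tri x₁ ≤ suc (t + tri x₂) → s ≤ suc t
    cancel {x₁ = x} refl le = +-cancelʳ-≤ (tri x) _ _ le
  ...   | inj₁ all = inj₁ λ j lt → extend j (m≤n⇒m<n∨m≡n (≤-pred lt))
    where
    extend : ∀ j → j < i ⊎ j ≡ i → x₁ + c₁ j ≡ x₂ + c₂ j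
    extend j (inj₁ lt)   = all j lt
    extend j (inj₂ refl) = eq
  -- If the smaller cliques already lack `R` vertices, the current one adds no more than its size.
  ...   | inj₂ le = inj₂ (≤-trans (≤-reflexive (shuffle (sumTo i c₁) (c₁ i) (sumTo i c₂) (c₂ i) R)) (+-mono-≤ le (cap i ≤-refl)))
    where
    shuffle : ∀ a b c d r → a + b + (c + d) + r ≡ (a + c + r) + (b + d)
    shuffle = solve-∀

  -- The cliques have odd size.
  halves : ∀ {a b} j → a ≡ b → a + b ≤ size j → a + b + 1 ≤ size j
  halves {a} j refl le = subst (_≤ size j) (+-comm 1 (a + a)) (≤∧≢⇒< le λ eq → even≢odd a (level j * level j + (R + 3))
    (trans (cong (a +_) (+-identityʳ a)) (trans eq (odd (level j * level j) R))))
    where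
    odd : ∀ q r → 2 * q + (2 * r + 7) ≡ suc (2 * (q + (r + 3)))
    odd = solve-∀

  -- The cliques contribute at most `level R - R` vertices, and the summand 2 accounts for the first
  -- two path vertices.
  class-bound : ∀ cs₁ cs₂ → 3 ≤ R → All (_≤ suc R) cs₁ → All (_≤ suc R) cs₂ →
    length cs₁ ≡ length cs₂ → edges R cs₁ ≡ edges R cs₂ →
    (∀ j → j < R → occ j cs₁ + occ j cs₂ ≤ size j) →
    occ R cs₁ + occ R cs₂ ≤ 1 → occ (suc R) cs₁ + occ (suc R) cs₂ ≤ 1 →
    length cs₁ + length cs₂ + R ≤ level R + 2
  class-bound cs₁ cs₂ 3≤R all₁ all₂ len edg cap x≤1 y≤1 = conclude (cascade R c₁ c₂ x₁≤1 x₂≤1 cap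
      (near cs₁ cs₂ edg x₁≤1 x₂≤1 y₂≤1) (near cs₂ cs₁ (≡-sym edg) x₂≤1 x₁≤1 y₁≤1))
    where
    c₁ = λ j → occ j cs₁
    c₂ = λ j → occ j cs₂
    x₁ = occ R cs₁
    x₂ = occ R cs₂
    y₁ = occ (suc R) cs₁
    y₂ = occ (suc R) cs₂
    x₁≤1 = m+n≤o⇒m≤o x₁ x≤1
    x₂≤1 = m+n≤o⇒n≤o x₁ x≤1
    y₁≤1 = m+n≤o⇒m≤o y₁ y≤1
    y₂≤1 = m+n≤o⇒n≤o y₁ y≤1

    near : ∀ cs cs′ → edges R cs ≡ edges R cs′ → occ R cs ≤ 1 → occ R cs′ ≤ 1 → occ (suc R) cs′ ≤ 1 →
           sumTo R (λ j → tri (occ R cs + occ j cs)) ≤ suc (sumTo R (λ j → tri (occ R cs′ + occ j cs′)))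
    near cs cs′ eq x≤1 x′≤1 y′≤1 = begin
      sumTo R (λ j → tri (occ R cs + occ j cs))                ≡⟨ tri-shift R cs (occ R cs) x≤1 ⟨
      E cs + occ R cs * total R cs                             ≤⟨ +-monoʳ-≤ (E cs) (*-monoʳ-≤ (occ R cs) (m≤m+n _ _)) ⟩
      edges R cs                                               ≡⟨ eq ⟩
      E cs′ + occ R cs′ * (total R cs′ + occ (suc R) cs′)      ≡⟨ distrib (E cs′) (occ R cs′) (total R cs′) (occ (suc R) cs′) ⟩
      occ R cs′ * occ (suc R) cs′ + (E cs′ + occ R cs′ * total R cs′)
        -- The edge between the two path vertices is the only one not absorbed into a clique; it is
        -- the source of the tolerance of 1.
        ≤⟨ +-mono-≤ (*-mono-≤ x′≤1 y′≤1) (≤-reflexive (tri-shift R cs′ (occ R cs′) x′≤1)) ⟩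
      suc (sumTo R (λ j → tri (occ R cs′ + occ j cs′)))        ∎
      where
      open ≤-Reasoning
      E : List ℕ → ℕ
      E cs = sumTo R (λ j → tri (occ j cs))
      distrib : ∀ e x t y → e + x * (t + y) ≡ x * y + (e + x * t)
      distrib = solve-∀

    finish : total R cs₁ + total R cs₂ + R ≤ level R → length cs₁ + length cs₂ + R ≤ level R + 2
    finish le = begin
      length cs₁ + length cs₂ + R     ≡⟨ cong₂ (λ a b → a + b + R) (length-total cs₁ all₁) (length-total cs₂ all₂) ⟩
      (total R cs₁ + x₁ + y₁) + (total R cs₂ + x₂ + y₂) + R  ≡⟨ shuffle (total R cs₁) x₁ y₁ (total R cs₂) x₂ y₂ R ⟩
      (total R cs₁ + total R cs₂ + R) + ((x₁ + x₂) + (y₁ + y₂))  ≤⟨ +-mono-≤ le (+-mono-≤ x≤1 y≤1) ⟩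
      level R + 2 ∎
      where
      open ≤-Reasoning
      shuffle : ∀ a b c d e f r → (a + b + c) + (d + e + f) + r ≡ (a + d + r) + ((b + e) + (c + f))
      shuffle = solve-∀

    -- An unequal number of first path vertices would have to be compensated in every clique.
    unbalanced : ∀ {cs cs′} → All (_≤ suc R) cs → All (_≤ suc R) cs′ → length cs ≡ length cs′ → occ R cs ≡ 1 → occ R cs′ ≡ 0 →
                 occ (suc R) cs ≤ 1 → ¬ (∀ j → j < R → occ R cs + occ j cs ≡ occ R cs′ + occ j cs′)
    unbalanced {cs} {cs′} a a′ len ex ex′ y≤1 h = <⇒≱ (s≤s (s≤s y≤1)) (begin
      3                                        ≤⟨ 3≤R ⟩
      R                                        ≤⟨ m≤m+n R _ ⟩
      R + occ (suc R) cs′                      ≡⟨ +-cancelˡ-≡ (total R cs) _ _ equal ⟨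
      suc (occ (suc R) cs)                     ∎)
      where
      open ≤-Reasoning
      shifted : total R cs′ ≡ R + total R cs
      shifted = trans (sumTo-cong R λ j lt → trans (cong (_+ occ j cs′) (≡-sym ex′)) (trans (≡-sym (h j lt)) (cong (_+ occ j cs) ex)))
                      (trans (sumTo-+ R (λ _ → 1) (λ j → occ j cs)) (cong (_+ total R cs) (sumTo-1 R)))
      equal : total R cs + suc (occ (suc R) cs) ≡ total R cs + (R + occ (suc R) cs′)
      equal = trans (shuffle₁ (total R cs) (occ (suc R) cs))
             (trans (cong (λ x → total R cs + x + occ (suc R) cs) (≡-sym ex))
             (trans (≡-sym (length-total cs a)) (trans len (trans (length-total cs′ a′)
             (trans (cong₂ (λ t x → t + x + occ (suc R) cs′) shifted ex′) (shuffle₂ R (total R cs) (occ (suc R) cs′)))))))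
        where
        shuffle₁ : ∀ a b → a + suc b ≡ a + 1 + b
        shuffle₁ = solve-∀
        shuffle₂ : ∀ r t y → (r + t) + 0 + y ≡ t + (r + y)
        shuffle₂ = solve-∀

    conclude : _ → length cs₁ + length cs₂ + R ≤ level R + 2
    conclude (inj₂ le) = finish le
    conclude (inj₁ h) = cases x₁ x₂ refl refl x≤1
      where
      cases : ∀ a b → x₁ ≡ a → x₂ ≡ b → a + b ≤ 1 → length cs₁ + length cs₂ + R ≤ level R + 2
      -- With the first path vertex in neither set, every clique is split evenly. Being odd, it has
      -- a vertex left over, which makes `R` of them.
      cases zero zero ex ex′ _ = finish (begin
        total R cs₁ + total R cs₂ + R               ≡⟨ cong₂ _+_ (≡-sym (sumTo-+ R c₁ c₂)) (≡-sym (sumTo-1 R)) ⟩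
        sumTo R (λ j → c₁ j + c₂ j) + sumTo R (λ _ → 1) ≡⟨ sumTo-+ R (λ j → c₁ j + c₂ j) (λ _ → 1) ⟨
        sumTo R (λ j → c₁ j + c₂ j + 1)             ≤⟨ sumTo-mono R (λ j lt → halves j
          (trans (cong (_+ c₁ j) (≡-sym ex)) (trans (h j lt) (cong (_+ c₂ j) ex′))) (cap j lt)) ⟩
        sumTo R size                                ≡⟨ level-sum R ⟩
        level R                                     ∎)
        where open ≤-Reasoning
      cases (suc zero) zero ex ex′ _ = ⊥-elim (unbalanced all₁ all₂ len ex ex′ y₁≤1 h)
      cases zero (suc zero) ex ex′ _ = ⊥-elim (unbalanced all₂ all₁ (≡-sym len) ex′ ex y₂≤1 λ j lt → ≡-sym (h j lt))
      cases (suc _) (suc _) _ _ (s≤s le) = ⊥-elim (n≮0 (≤-trans (s≤s z≤n) (≤-trans (≤-reflexive (≡-sym (+-suc _ _))) le)))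
      cases zero (suc (suc _)) _ _ (s≤s ())
      cases (suc (suc _)) zero _ _ (s≤s ())

-- Homometric sets that both meet the cliques.

occ-filter : ∀ (κ : ℕ → ℕ) j xs → occ j (map κ xs) ≡ length (filter (λ x → κ x ≟ j) xs)
occ-filter κ j []       = refl
occ-filter κ j (x ∷ xs) with κ x ≟ j
... | yes eq = trans (cong suc (occ-filter κ j xs)) (cong length (≡-sym (filter-accept (λ x → κ x ≟ j) eq)))
... | no neq = trans (occ-filter κ j xs) (cong length (≡-sym (filter-reject (λ x → κ x ≟ j) neq)))

occ-interval : ∀ (κ : ℕ → ℕ) j a k {xs} → Unique xs → (∀ {x} → κ x ≡ j → a ≤ x × x < a + k) → occ j (map κ xs) ≤ k
occ-interval κ j a k {xs} u h = subst (_≤ k) (≡-sym (occ-filter κ j xs))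
  (unique-interval (Unique.filter⁺ (λ x → κ x ≟ j) u) (All.map h (All.all-filter (λ x → κ x ≟ j) xs)))

-- Applied with `c` the greatest depth: a distance that large forces an end at that depth.
∣-∣-endpoint : ∀ {a b c} → a ≤ c → b ≤ c → ∣ a - b ∣ ≡ c → a ≡ c ⊎ b ≡ c
∣-∣-endpoint {a} {b} {c} a≤c b≤c eq with ∣m-n∣≡[m∸n]∨[n∸m] a b
... | inj₁ e = inj₁ (≤-antisym a≤c (≤-trans (≤-reflexive (trans (≡-sym eq) e)) (m∸n≤m a b)))
... | inj₂ e = inj₂ (≤-antisym b≤c (≤-trans (≤-reflexive (trans (≡-sym eq) e)) (m∸n≤m b a)))

∸-< : ∀ {a b c} → a ≤ b → b < a + c → b ∸ a < c
∸-< {a} a≤b lt = ≤-trans (≤-reflexive (≡-sym (+-∸-assoc 1 a≤b))) (m≤n+o⇒m∸n≤o _ a lt)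

∣-∣-interior : ∀ {lo a b c} → lo ≤ a → a ≤ lo + c → lo < b → b < lo + c → ∣ a - b ∣ < c
∣-∣-interior {lo} {a} {b} {c} lo≤a a≤hi lo<b b<hi with ≤-total a b
... | inj₁ a≤b = subst (_< c) (≡-sym (m≤n⇒∣m-n∣≡n∸m a≤b)) (∸-< a≤b (<-≤-trans b<hi (+-monoˡ-≤ c lo≤a)))
... | inj₂ b≤a = subst (_< c) (trans (≡-sym (m≤n⇒∣m-n∣≡n∸m b≤a)) (∣-∣-comm b a)) (∸-< b≤a (≤-<-trans a≤hi (+-monoˡ-< c lo<b)))

module Bound (R : ℕ) where
  open Cascade R

  N : ℕ
  N = level R

  -- Clique `j` occupies the interval from `level j` up to, but excluding, `level (suc j)`; the
  -- search starts at the largest.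
  block : ℕ → ℕ → ℕ
  block zero    x = 0
  block (suc i) x with level i ≤? x
  ... | yes _ = i
  ... | no _  = block i x

  block-spec : ∀ i {x} → x < level i → block i x < i × level (block i x) ≤ x × x < level (suc (block i x))
  block-spec (suc i) {x} lt with level i ≤? x
  ... | yes le = ≤-refl , le , lt
  ... | no ¬le with block-spec i (≰⇒> ¬le)
  ...   | b<i , lo , hi = m<n⇒m<1+n b<i , lo , hi

  open Broom N (block R) public

  -- Labels below `R` are cliques and `R + p` is the path vertex number `p`, in agreement with the
  -- convention of `edges`.
  class : ℕ → ℕ → ℕ
  class zero    x = block R x
  class (suc p) x = R + p

  κ : ℕ → ℕ
  κ x = class (depth x) x

  κ-clique : ∀ {x} → depth x ≡ 0 → κ x ≡ block R x
  κ-clique e rewrite e = refl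

  κ-path : ∀ {x p} → depth x ≡ suc p → κ x ≡ R + p
  κ-path e rewrite e = refl

  κ-clique< : ∀ {x} → depth x ≡ 0 → κ x < R
  κ-clique< {x} e = subst (_< R) (≡-sym (κ-clique {x} e)) (proj₁ (block-spec R (depth≡0⇒< e)))

  κ<R⇒range : ∀ {x j} → j < R → κ x ≡ j → level j ≤ x × x < level j + size j
  κ<R⇒range {x} j<R refl with depth-view x
  ... | inj₁ e rewrite κ-clique {x} e = proj₂ (block-spec R (depth≡0⇒< e))
  ... | inj₂ (p , e) rewrite κ-path {x} e = ⊥-elim (m+n≮m R p j<R)

  κ≥R⇒range : ∀ {x} p → κ x ≡ R + p → N + p ≤ x × x < N + p + 1
  κ≥R⇒range {x} p eq with depth-view x
  ... | inj₁ e = ⊥-elim (m+n≮m R p (subst (_< R) eq (κ-clique< {x} e)))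
  ... | inj₂ (q , e) with refl ← +-cancelˡ-≡ R q p (trans (≡-sym (κ-path {x} e)) eq) =
        ≤-reflexive (≡-sym (depth-suc e)) , ≤-reflexive (trans (cong suc (depth-suc e)) (+-comm 1 (N + p)))

  -- Summed over a distance list, this indicator counts the edges within a set.
  one : ℕ → ℕ
  one v = δ v 1

  data Near (x : ℕ) : Set where
    clique : depth x ≡ 0 → Near x
    first  : depth x ≡ 1 → Near x
    second : depth x ≡ 2 → Near x

  near : ∀ {x} → depth x ≤ 2 → Near x
  near {x} le with depth x in e
  ... | 0 = clique e
  ... | 1 = first e
  ... | 2 = second e
  near (s≤s (s≤s ())) | suc (suc (suc _))

  κ-first : ∀ {x} → depth x ≡ 1 → κ x ≡ R
  κ-first {x} e = trans (κ-path {x} e) (+-identityʳ R)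

  κ-second : ∀ {x} → depth x ≡ 2 → κ x ≡ suc R
  κ-second {x} e = trans (κ-path {x} e) (+-comm R 1)

  d-depths : ∀ {x y p q} → depth x ≡ p → depth y ≡ suc q → d x y ≡ ∣ p - suc q ∣
  d-depths {x} {y} ex ey with d-path x y
  ... | inj₂ e rewrite e | ex | ey = refl
  ... | inj₁ (_ , e) with () ← trans (≡-sym e) ey

  one-clique : ∀ {x y} → depth x ≡ 0 → x ≢ y → Near y → one (d x y) ≡ δ (κ y) (κ x) + δ (κ y) R
  one-clique {x} {y} ex x≢y (clique ey)
    rewrite d-clique ex ey | δ-≢ (<⇒≢ (κ-clique< {y} ey)) | κ-clique {x} ex | κ-clique {y} ey
    with x ≟ y | block R x ≟ block R y | block R y ≟ block R x
  ... | yes x≡y | _     | _     = ⊥-elim (x≢y x≡y)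
  ... | no _    | yes _ | yes _ = refl
  ... | no _    | no _  | no _  = refl
  ... | no _    | yes p | no ¬q = ⊥-elim (¬q (≡-sym p))
  ... | no _    | no ¬p | yes q = ⊥-elim (¬p (≡-sym q))
  one-clique {x} {y} ex x≢y (first ey)
    rewrite d-depths {x} {y} ex ey | κ-first {y} ey | δ-≢ (>⇒≢ (κ-clique< {x} ex)) | δ-≡ R = refl
  one-clique {x} {y} ex x≢y (second ey)
    rewrite d-depths {x} {y} ex ey | κ-second {y} ey | δ-≢ (>⇒≢ (m<n⇒m<1+n (κ-clique< {x} ex))) | δ-≢ (>⇒≢ (n<1+n R)) = refl

  -- The sum `sumTo R (δ (κ y))` is the indicator of `y` being a clique vertex.
  one-first : ∀ {x y} → depth x ≡ 1 → Near y → one (d x y) ≡ sumTo R (δ (κ y)) + δ (κ y) (suc R)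
  one-first {x} {y} ex (clique ey)
    rewrite d-sym x y | d-depths {y} {x} ey ex | sumTo-δ (κ-clique< {y} ey) | δ-≢ (<⇒≢ (m<n⇒m<1+n (κ-clique< {y} ey))) = refl
  one-first {x} {y} ex (first ey)
    rewrite d-depths {x} {y} ex ey | κ-first {y} ey | sumTo-δ≥ {R} {R} ≤-refl | δ-≢ (<⇒≢ (n<1+n R)) = refl
  one-first {x} {y} ex (second ey)
    rewrite d-depths {x} {y} ex ey | κ-second {y} ey | sumTo-δ≥ {R} (n≤1+n R) | δ-≡ (suc R) = refl

  one-second : ∀ {x y} → depth x ≡ 2 → Near y → one (d x y) ≡ δ (κ y) R
  one-second {x} {y} ex (clique ey)
    rewrite d-sym x y | d-depths {y} {x} ey ex | δ-≢ (<⇒≢ (κ-clique< {y} ey)) = refl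
  one-second {x} {y} ex (first ey) rewrite d-depths {x} {y} ex ey | κ-first {y} ey | δ-≡ R = refl
  one-second {x} {y} ex (second ey) rewrite d-depths {x} {y} ex ey | κ-second {y} ey | δ-≢ (>⇒≢ (n<1+n R)) = refl

  row : ℕ → List ℕ → ℕ
  row x ys = sum (map one (map (d x) ys))

  row-clique : ∀ {x ys} → depth x ≡ 0 → All (x ≢_) ys → All (λ y → depth y ≤ 2) ys →
               row x ys ≡ occ (κ x) (map κ ys) + occ R (map κ ys)
  row-clique ex [] [] = refl
  row-clique {x} {y ∷ ys} ex (x≢y ∷ x∉) (le ∷ les) =
    trans (cong₂ _+_ (one-clique ex x≢y (near le)) (row-clique ex x∉ les))
          (+-interchange (δ (κ y) (κ x)) (δ (κ y) R) (occ (κ x) (map κ ys)) (occ R (map κ ys)))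

  row-first : ∀ {x ys} → depth x ≡ 1 → All (λ y → depth y ≤ 2) ys →
              row x ys ≡ total R (map κ ys) + occ (suc R) (map κ ys)
  row-first ex [] = ≡-sym (trans (+-identityʳ _) (sumTo-0 R))
  row-first {x} {y ∷ ys} ex (le ∷ les) =
    trans (cong₂ _+_ (one-first ex (near le)) (row-first ex les))
    (trans (+-interchange (sumTo R (δ (κ y))) (δ (κ y) (suc R)) (total R (map κ ys)) (occ (suc R) (map κ ys)))
           (cong (_+ occ (suc R) (map κ (y ∷ ys))) (≡-sym (sumTo-+ R (δ (κ y)) (λ j → occ j (map κ ys))))))

  row-second : ∀ {x ys} → depth x ≡ 2 → All (λ y → depth y ≤ 2) ys → row x ys ≡ occ R (map κ ys)
  row-second ex [] = refl
  row-second ex (le ∷ les) = cong₂ _+_ (one-second ex (near le)) (row-second ex les)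

  row-edges : ∀ {x ys} → All (x ≢_) ys → depth x ≤ 2 → All (λ y → depth y ≤ 2) ys →
              row x ys + edges R (map κ ys) ≡ edges R (κ x ∷ map κ ys)
  row-edges {x} {ys} x∉ le les with near {x} le
  ... | clique e = trans (cong (_+ edges R (map κ ys)) (row-clique e x∉ les)) (≡-sym (edges-clique (map κ ys) (κ-clique< {x} e)))
  ... | first e rewrite κ-first {x} e = trans (cong (_+ edges R (map κ ys)) (row-first e les)) (≡-sym (edges-first R (map κ ys)))
  ... | second e rewrite κ-second {x} e = trans (cong (_+ edges R (map κ ys)) (row-second e les)) (≡-sym (edges-second R (map κ ys)))

  -- Turns homometry into an equation between class counts, to which `class-bound` applies.
  edges-spec : ∀ {xs} → Unique xs → All (λ y → depth y ≤ 2) xs → sum (map one (pairwise d xs)) ≡ edges R (map κ xs)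
  edges-spec []       []         = ≡-sym (trans (+-identityʳ _) (sumTo-0 R))
  edges-spec {x ∷ xs} (x∉ ∷ u) (le ∷ les) = trans (cong sum (map-++ one (map (d x) xs) (pairwise d xs)))
    (trans (sum-++ (map one (map (d x) xs)) _) (trans (cong (row x xs +_) (edges-spec u les)) (row-edges x∉ le les)))

  depth-injective : ∀ {x y k} → depth x ≡ suc k → depth y ≡ suc k → x ≡ y
  depth-injective ex ey = trans (depth-suc ex) (≡-sym (depth-suc ey))

  deepest : ∀ xs → All (λ x → depth x ≤ 2) xs ⊎
            ∃ λ z → z ∈ xs × 3 ≤ depth z × All (λ x → depth x ≤ depth z) xs
  deepest []       = inj₁ []
  deepest (x ∷ xs) with deepest xs | depth x ≤? 2
  ... | inj₁ all | yes le = inj₁ (le ∷ all)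
  ... | inj₁ all | no ¬le = inj₂ (x , here refl , ≰⇒> ¬le , ≤-refl ∷ All.map (λ le → ≤-trans le (<⇒≤ (≰⇒> ¬le))) all)
  ... | inj₂ (z , z∈ , 3≤ , all) | _ with depth x ≤? depth z
  ...   | yes le = inj₂ (z , there z∈ , 3≤ , le ∷ all)
  ...   | no ¬le = inj₂ (x , here refl , ≤-trans 3≤ (<⇒≤ (≰⇒> ¬le)) , ≤-refl ∷ All.map (λ le → ≤-trans le (<⇒≤ (≰⇒> ¬le))) all)

  d-to-clique : ∀ {z a k} → depth z ≡ suc k → depth a ≡ 0 → d z a ≡ depth z
  d-to-clique ez ea rewrite ez | ea = refl

  positive : ∀ {x k} → suc k ≤ depth x → ∃ λ p → depth x ≡ suc p
  positive {x} le with depth x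
  ... | suc p = p , refl

  d≤ : ∀ {x y k} → 2 ≤ k → depth x ≤ k → depth y ≤ k → d x y ≤ k
  d≤ {x} {y} 2≤k lx ly with d-path x y
  ... | inj₁ (ex , ey) = ≤-trans (≤-reflexive (d-clique ex ey)) (≤-trans (hd≤2 x y) 2≤k)
  ... | inj₂ e = ≤-trans (≤-reflexive e) (≤-trans (∣m-n∣≤m⊔n (depth x) (depth y)) (⊔-lub lx ly))

  -- The distance from `z` to `a` is `depth z`. In `ys` it is too large for two clique vertices, and
  -- along the line it needs an end at depth `depth z`, where `z` is the only vertex.
  deepest-distance : ∀ {xs ys z a} → pairwise d xs ↭ pairwise d ys → z ∈ xs → a ∈ xs → depth a ≡ 0 → 3 ≤ depth z →
                     All (λ y → depth y ≤ depth z) ys → z ∉ ys → ⊥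
  deepest-distance {xs} {ys} {z} {a} p z∈ a∈ ea 3≤ all z∉
    with k , ez ← positive 3≤
    with u , v , zs , q , eq ← ∈-pairwise⁻ ys (∈-resp-↭ p (∈-pairwise⁺ d-sym z∈ a∈ λ { refl → n≮0 (subst (3 ≤_) ea 3≤) }))
    with u∈ ← ∈-resp-↭ (↭-sym q) (here refl) | v∈ ← ∈-resp-↭ (↭-sym q) (there (here refl))
    with d-path u v
  ... | inj₁ (eu , ev) = <⇒≱ 3≤ (≤-trans (≤-reflexive (trans (≡-sym (d-to-clique ez ea)) (trans eq (d-clique eu ev)))) (hd≤2 u v))
  ... | inj₂ e with ∣-∣-endpoint (All.lookup all u∈) (All.lookup all v∈) (trans (≡-sym e) (trans (≡-sym eq) (d-to-clique ez ea)))
  ...   | inj₁ eu = z∉ (subst (_∈ ys) (depth-injective (trans eu ez) ez) u∈)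
  ...   | inj₂ ev = z∉ (subst (_∈ ys) (depth-injective (trans ev ez) ez) v∈)

  -- Homometric sets of which one lies on the path.

  InPath : ℕ → Set
  InPath x = ∃ λ p → depth x ≡ suc p

  d-straight : ∀ {x y} → InPath x → InPath y → d x y ≡ ∣ x - y ∣
  d-straight {x} {y} (p , ex) (q , ey) = begin
    d x y                    ≡⟨ d-depths {x} {y} ex ey ⟩
    ∣ p - q ∣                ≡⟨ ∣m+n-m+o∣≡∣n-o∣ N p q ⟨
    ∣ N + p - N + q ∣        ≡⟨ cong₂ ∣_-_∣ (depth-suc ex) (depth-suc ey) ⟨
    ∣ x - y ∣                ∎
    where open ≡.≡-Reasoning

  -- Since `v = u + d u v`, the bound on `d v t` keeps `t` from falling below `u`, and the bound on
  -- `d u t` keeps it from passing `v`.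
  interior : ∀ {u v t} → u < v → InPath u → InPath v → InPath t → u ≢ t → v ≢ t →
             d u t ≤ d u v → d v t ≤ d u v → u < t × t < u + d u v
  interior {u} {v} {t} u<v pu pv pt u≢t v≢t ut≤ vt≤ =
    ≤∧≢⇒< (+-cancelʳ-≤ M u t (subst (_≤ t + M) v≡ (≤-trans (m≤n+∣m-n∣ v t) (+-monoʳ-≤ t (subst (_≤ M) (d-straight pv pt) vt≤))))) u≢t ,
    subst (t <_) v≡ (≤∧≢⇒< (≤-trans (m≤n+∣m-n∣ t u) (≤-trans
      (+-monoʳ-≤ u (subst (_≤ M) (trans (d-straight pu pt) (∣-∣-comm u t)) ut≤))
      (≤-reflexive (≡-sym v≡)))) λ eq → v≢t (≡-sym eq))
    where
    M = d u v
    v≡ : v ≡ u + M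
    v≡ = trans (≡-sym (m+[n∸m]≡n (<⇒≤ u<v))) (cong (u +_) (≡-sym (trans (d-straight pu pv) (m≤n⇒∣m-n∣≡n∸m (<⇒≤ u<v)))))

  -- By `interior`, `zs` lies strictly between `u` and `v`, and every pair other than these two has
  -- a member in `zs`.
  diameter-once : ∀ {u v zs} → u < v → Unique (u ∷ v ∷ zs) → All InPath (u ∷ v ∷ zs) →
                  All (_≤ d u v) (pairwise d (u ∷ v ∷ zs)) →
                  All (_< d u v) (map (d u) zs ++ map (d v) zs ++ pairwise d zs)
  diameter-once {u} {v} {zs} u<v ((_ ∷ u∉) ∷ v∉ ∷ _) (pu ∷ pv ∷ pzs) (_ ∷ bound) =
    All.++⁺ (All.map⁺ (All.tabulate (close pu ≤-refl (m≤m+n u M))))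
    (All.++⁺ (All.map⁺ (All.tabulate (close pv (<⇒≤ u<v) v≤)))
    (All-pairwise λ s∈ t∈ → close (All.lookup pzs s∈) (<⇒≤ (proj₁ (inside s∈))) (<⇒≤ (proj₂ (inside s∈))) t∈))
    where
    M = d u v
    uz≤ = All.map⁻ (All.++⁻ˡ (map (d u) zs) bound)
    vz≤ = All.map⁻ (All.++⁻ˡ (map (d v) zs) (All.++⁻ʳ (map (d u) zs) bound))
    inside : ∀ {t} → t ∈ zs → u < t × t < u + M
    inside t∈ = interior u<v pu pv (All.lookup pzs t∈) (All.lookup u∉ t∈) (All.lookup v∉ t∈) (All.lookup uz≤ t∈) (All.lookup vz≤ t∈)
    v≤ : v ≤ u + M
    v≤ = ≤-trans (m≤n+∣m-n∣ v u) (+-monoʳ-≤ u (≤-reflexive (trans (∣-∣-comm v u) (≡-sym (d-straight pu pv)))))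
    close : ∀ {s} → InPath s → u ≤ s → s ≤ u + M → ∀ {t} → t ∈ zs → d s t < M
    close ps u≤s s≤ t∈ = ≤-trans (s≤s (≤-reflexive (d-straight ps (All.lookup pzs t∈))))
      (∣-∣-interior u≤s s≤ (proj₁ (inside t∈)) (proj₂ (inside t∈)))

  -- All vertices are within 2 of the head, hence in an interval of 5 numbers. This is why sets of
  -- size at most 5 are treated apart.
  path-spread : ∀ {xs} → Unique xs → All InPath xs → All (_≤ 2) (pairwise d xs) → length xs ≤ 5
  path-spread {[]}     _ _ _ = z≤n
  path-spread {x ∷ xs} u (px ∷ pxs) bound = unique-interval {x ∸ 2} u
    ((m∸n≤m x 2 , ≤-trans (s≤s (m≤n+m∸n x 2)) (≤-trans (m≤m+n _ 2) (≤-reflexive (regroup (x ∸ 2))))) ∷ All.tabulate near-x)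
    where
    regroup : ∀ a → suc (2 + a) + 2 ≡ a + 5
    regroup = solve-∀
    near-x : ∀ {y} → y ∈ xs → x ∸ 2 ≤ y × y < x ∸ 2 + 5
    near-x {y} y∈ =
      m≤n+o⇒m∸n≤o x 2 (≤-trans (m≤∣m-n∣+n x y) (+-monoˡ-≤ y close)) ,
      ≤-trans (s≤s (≤-trans (m≤∣m-n∣+n y x) (≤-trans (+-mono-≤ (≤-trans (≤-reflexive (∣-∣-comm y x)) close) (m≤n+m∸n x 2)) (≤-reflexive (+-comm 2 _)))))
              (≤-reflexive (regroup (x ∸ 2)))
      where
      close : ∣ x - y ∣ ≤ 2
      close = subst (_≤ 2) (d-straight px (All.lookup pxs y∈)) (All.lookup (All.map⁻ (All.++⁻ˡ (map (d x) xs) bound)) y∈)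

  -- Once the entry of the pair `u`, `v` is dropped, a second `M` would have to be among distances
  -- that `diameter-once` shows to be smaller.
  diameter-not-twice : ∀ {xs u v ws M cs} → Unique xs → All InPath xs → xs ↭ u ∷ v ∷ ws → u < v → d u v ≡ M →
                       All (_≤ M) (pairwise d xs) → pairwise d xs ↭ M ∷ M ∷ cs → ⊥
  diameter-not-twice {u = u} {v} u! path r u<v refl bound p = <-irrefl refl (All.lookup
    (diameter-once u<v (Unique-resp-↭ r u!) (All-resp-↭ r path) (All-resp-↭ (pairwise-↭ d-sym r) bound))
    (∈-resp-↭ (↭-sym (drop-∷ {x = d u v} (↭-trans (↭-sym (pairwise-↭ d-sym r)) p))) (here refl)))

  -- A deepest vertex of ys is equally far from a and b, so the largest distance of ys occurs twice.
  two-cliques : ∀ {xs ys a b} → Unique xs → pairwise d xs ↭ pairwise d ys → All InPath xs → 6 ≤ length xs →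
                a ∈ ys → depth a ≡ 0 → b ∈ ys → depth b ≡ 0 → a ≢ b → ⊥
  two-cliques {xs} {ys} {a} {b} u p path 6≤ a∈ ea b∈ eb a≢b with deepest ys
  ... | inj₁ all = <⇒≱ 6≤ (path-spread u path (All-resp-↭ (↭-sym p)
                     (All-pairwise λ s∈ t∈ → d≤ ≤-refl (All.lookup all s∈) (All.lookup all t∈))))
  ... | inj₂ (z , z∈ , 3≤ , all)
    with k , ez ← positive 3≤
    with zs , q ← extract₃ z∈ a∈ b∈ (λ { refl → n≮0 (subst (3 ≤_) ea 3≤) }) (λ { refl → n≮0 (subst (3 ≤_) eb 3≤) }) a≢b
    with s , t , ws , r , eq ← ∈-pairwise⁻ xs (∈-resp-↭ (↭-sym (↭-trans p (pairwise-↭ d-sym q))) (here refl))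
    with bound ← All-resp-↭ (↭-sym p) (All-pairwise {f = d} λ s∈ t∈ → d≤ (<⇒≤ 3≤) (All.lookup all s∈) (All.lookup all t∈))
    with p′ ← subst₂ (λ k l → pairwise d xs ↭ k ∷ l ∷ map (d z) zs ++ pairwise d (a ∷ b ∷ zs))
           (d-to-clique ez ea) (d-to-clique ez eb) (↭-trans p (pairwise-↭ d-sym q))
    with <-cmp s t
  ... | tri≈ _ refl _ = n≮0 (subst (3 ≤_) (trans (≡-sym (d-to-clique ez ea)) (trans eq (d-refl s))) 3≤)
  ... | tri< u<v _ _ = diameter-not-twice u path r u<v (trans (≡-sym eq) (d-to-clique ez ea)) bound p′
  ... | tri> _ _ v<u = diameter-not-twice u path (↭-trans r (swap _ _ refl)) v<u (trans (d-sym t s) (trans (≡-sym eq) (d-to-clique ez ea))) bound p′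

  notClique⇒InPath : ∀ {x} → depth x ≢ 0 → InPath x
  notClique⇒InPath {x} neq with depth-view x
  ... | inj₁ e  = ⊥-elim (neq e)
  ... | inj₂ pe = pe

  path-or-clique : ∀ xs → All InPath xs ⊎ ∃ λ a → a ∈ xs × depth a ≡ 0
  path-or-clique xs with any? (λ x → depth x ≟ 0) xs
  ... | yes h = inj₂ (find h)
  ... | no ¬h = inj₁ (All.map notClique⇒InPath (All.¬Any⇒All¬ xs ¬h))

  path-length : ∀ {m xs ys} → Unique xs → Unique ys → (∀ {z} → z ∈ xs → z ∈ ys → ⊥) → All InPath xs → All InPath ys →
                All (_< N + m) xs → All (_< N + m) ys → length xs + length ys ≤ m
  path-length {m} {xs} {ys} uˣ uʸ disjoint pˣ pʸ bˣ bʸ = subst (_≤ m) (length-++ xs)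
    (unique-interval {N} (Unique.++⁺ uˣ uʸ λ (x∈ , y∈) → disjoint x∈ y∈) (All.++⁺ (range pˣ bˣ) (range pʸ bʸ)))
    where
    range : ∀ {zs} → All InPath zs → All (_< N + m) zs → All (λ x → N ≤ x × x < N + m) zs
    range p b = All.zipWith (λ ((k , e) , lt) → subst (N ≤_) (≡-sym (depth-suc e)) (m≤m+n N k) , lt) (p , b)

  -- By `two-cliques`, `ys` has at most one clique vertex. Without it both sets lie on the path,
  -- which has `m` vertices.
  one-path : ∀ {m xs ys} → Unique xs → Unique ys → (∀ {z} → z ∈ xs → z ∈ ys → ⊥) → pairwise d xs ↭ pairwise d ys →
             All InPath xs → 6 ≤ length xs → All (_< N + m) xs → All (_< N + m) ys → length xs + length ys ≤ suc m
  one-path {m} {xs} {ys} uˣ uʸ disjoint p pˣ 6≤ bˣ bʸ with path-or-clique ys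
  ... | inj₁ pʸ = m≤n⇒m≤1+n (path-length uˣ uʸ disjoint pˣ pʸ bˣ bʸ)
  ... | inj₂ (a , a∈ , ea) with zs , q ← extract a∈ with a∉ ∷ uᶻ ← Unique-resp-↭ q uʸ with path-or-clique zs
  ...   | inj₂ (b , b∈ , eb) = ⊥-elim (two-cliques uˣ p pˣ 6≤ a∈ ea (∈-resp-↭ (↭-sym q) (there b∈)) eb (All.lookup a∉ b∈))
  ...   | inj₁ pᶻ = subst (_≤ suc m) (trans (≡-sym (+-suc (length xs) (length zs))) (cong (length xs +_) (≡-sym (↭-length q))))
          (s≤s (path-length uˣ uᶻ (λ z∈xs z∈zs → disjoint z∈xs (∈-resp-↭ (↭-sym q) (there z∈zs))) pˣ pᶻ bˣ (All.tail (All-resp-↭ q bʸ))))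

  -- Combination of the two cases.

  module _ (3≤R : 3 ≤ R) {xs ys : List ℕ} (uˣ : Unique xs) (uʸ : Unique ys)
           (disjoint : ∀ {z} → z ∈ xs → z ∈ ys → ⊥) (len : length xs ≡ length ys)
           (hom : pairwise d xs ↭ pairwise d ys) where

    both-cliques : All (λ x → depth x ≤ 2) (xs ++ ys) → length xs + length ys + R ≤ N + 2
    both-cliques all = subst₂ (λ a b → a + b + R ≤ N + 2) (length-map κ xs) (length-map κ ys)
      (class-bound (map κ xs) (map κ ys) 3≤R (classes≤ allˣ) (classes≤ allʸ)
        (trans (length-map κ xs) (trans len (≡-sym (length-map κ ys))))
        -- Of the homometry, only the equal numbers of pairs at distance 1 enter here.
        (trans (≡-sym (edges-spec uˣ allˣ)) (trans (sum-↭ (Perm.map⁺ one hom)) (edges-spec uʸ allʸ)))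
        (λ j lt → capacity j (level j) (size j) (κ<R⇒range lt))
        (capacity R (N + 0) 1 λ {x} e → κ≥R⇒range {x} 0 (trans e (≡-sym (+-identityʳ R))))
        (capacity (suc R) (N + 1) 1 λ {x} e → κ≥R⇒range {x} 1 (trans e (+-comm 1 R))))
      where
      allˣ = All.++⁻ˡ xs all
      allʸ = All.++⁻ʳ xs all
      class≤ : ∀ {x} → Near x → κ x ≤ suc R
      class≤ {x} (clique e) = ≤-trans (<⇒≤ (κ-clique< {x} e)) (n≤1+n R)
      class≤ {x} (first e)  = ≤-trans (≤-reflexive (κ-first {x} e)) (n≤1+n R)
      class≤ {x} (second e) = ≤-reflexive (κ-second {x} e)
      classes≤ : ∀ {zs} → All (λ x → depth x ≤ 2) zs → All (_≤ suc R) (map κ zs)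
      classes≤ all = All.map⁺ (All.map (λ le → class≤ (near le)) all)
      capacity : ∀ j a k → (∀ {x} → κ x ≡ j → a ≤ x × x < a + k) → occ j (map κ xs) + occ j (map κ ys) ≤ k
      capacity j a k h = subst (_≤ k) (trans (cong (occ j) (map-++ κ xs ys)) (occ-++ j (map κ xs) (map κ ys)))
                               (occ-interval κ j a k (Unique.++⁺ uˣ uʸ λ (x∈ , y∈) → disjoint x∈ y∈) h)

    both-touch : ∀ {a b} → a ∈ xs → depth a ≡ 0 → b ∈ ys → depth b ≡ 0 → length xs + length ys + R ≤ N + 2
    both-touch a∈ ea b∈ eb with deepest (xs ++ ys)
    ... | inj₁ all = both-cliques all
    ... | inj₂ (z , z∈ , 3≤ , all) with ∈-++⁻ xs z∈
    ...   | inj₁ z∈xs = ⊥-elim (deepest-distance hom z∈xs a∈ ea 3≤ (All.++⁻ʳ xs all) λ z∈ys → disjoint z∈xs z∈ys)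
    ...   | inj₂ z∈ys = ⊥-elim (deepest-distance (↭-sym hom) z∈ys b∈ eb 3≤ (All.++⁻ˡ xs all) λ z∈xs → disjoint z∈xs z∈ys)

    homometric-bound : ∀ {m} → All (_< N + m) xs → All (_< N + m) ys →
      length xs ≤ 5 ⊎ (length xs + length ys ≤ suc m) ⊎ (length xs + length ys + R ≤ N + 2)
    homometric-bound {m} bˣ bʸ with 6 ≤? length xs
    ... | no ¬6≤ = inj₁ (≤-pred (≰⇒> ¬6≤))
    ... | yes 6≤ with path-or-clique xs | path-or-clique ys
    ...   | inj₂ (a , a∈ , ea) | inj₂ (b , b∈ , eb) = inj₂ (inj₂ (both-touch a∈ ea b∈ eb))
    ...   | inj₁ pˣ | _ = inj₂ (inj₁ (one-path uˣ uʸ disjoint hom pˣ 6≤ bˣ bʸ))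
    ...   | inj₂ _  | inj₁ pʸ = inj₂ (inj₁ (subst (_≤ suc m) (+-comm (length ys) (length xs))
              (one-path uʸ uˣ (λ y∈ x∈ → disjoint x∈ y∈) (↭-sym hom) pʸ (subst (6 ≤_) len 6≤) bʸ bˣ)))

-- The extremal graph, its order and the final estimate.

-- R is a variable rather than 6 + e, because level (6 + e) unfolds.
module Extremal (e R : ℕ) (R≡6+e : R ≡ 6 + e) where
  open Cascade R
  open Bound R

  k : ℕ
  k = N ∸ R

  R+9≤N : R + (R + 7) ≤ N
  R+9≤N = begin
    R + (R + 7)          ≡⟨ regroup R ⟩
    -- The smallest clique alone has `2 * R + 7` vertices.
    level 1              ≤⟨ first≤ (5 + e) ⟩
    level (6 + e)        ≡⟨ cong level R≡6+e ⟨
    N                    ∎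
    where
    open ≤-Reasoning
    regroup : ∀ r → r + (r + 7) ≡ 2 * r + 7
    regroup = solve-∀
    first≤ : ∀ j → level 1 ≤ level (suc j)
    first≤ zero    = ≤-refl
    first≤ (suc j) = ≤-trans (first≤ j) (m≤m+n _ _)

  6≤R : 6 ≤ R
  6≤R = subst (6 ≤_) (≡-sym R≡6+e) (m≤m+n 6 e)

  N≡R+k : N ≡ R + k
  N≡R+k = ≡-sym (m+[n∸m]≡n (m+n≤o⇒m≤o R R+9≤N))

  R+7≤k : R + 7 ≤ k
  R+7≤k = +-cancelˡ-≤ R _ _ (subst (R + (R + 7) ≤_) N≡R+k R+9≤N)

  -- A path with `k + 1` vertices balances the two cases: the bound from the path and the bound from
  -- the cliques both become `k + 2`.
  order : ℕ
  order = N + suc k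

  1≤N : 1 ≤ N
  1≤N = ≤-trans (≤-trans (s≤s z≤n) 6≤R) (m+n≤o⇒m≤o R R+9≤N)

  2≤1+k : 2 ≤ suc k
  2≤1+k = s≤s (≤-trans (≤-trans (s≤s z≤n) 6≤R) (m+n≤o⇒m≤o R R+7≤k))

  extremal : Graph order
  extremal = broom 1≤N 2≤1+k

  -- By `dist-unitGraph` all distances are finite, so the default 0 never replaces a value.
  D-extremal : ∀ S → map (fromMaybe 0) (D extremal S) ≡ pairwise d (map toℕ S)
  D-extremal S = trans (≡-sym (map-∘ (pairs S))) (trans
    (map-cong (λ p → cong (fromMaybe 0) (dist-unitGraph (dFin-pathMetric 1≤N 2≤1+k) (proj₁ p) (proj₂ p))) (pairs S))
    (trans (pairs-pairwise _ S) (≡-sym (pairwise-map toℕ d S))))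

  homometric-ℕ : ∀ S₁ S₂ → Homometric extremal S₁ S₂ → pairwise d (map toℕ S₁) ↭ pairwise d (map toℕ S₂)
  homometric-ℕ S₁ S₂ hom = subst₂ _↭_ (D-extremal S₁) (D-extremal S₂) (Perm.map⁺ (fromMaybe 0) hom)

  toℕ-disjoint : ∀ {S₁ S₂ : List (Fin order)} → Disjoint S₁ S₂ → ∀ {z} → z ∈ map toℕ S₁ → z ∈ map toℕ S₂ → ⊥
  toℕ-disjoint disj z∈₁ z∈₂ with ∈-map⁻ toℕ z∈₁ | ∈-map⁻ toℕ z∈₂
  ... | x , x∈ , refl | y , y∈ , eq with refl ← Fin.toℕ-injective eq = disj x x∈ y∈

  toℕ-bounded : ∀ (S : List (Fin order)) → All (_< order) (map toℕ S)
  toℕ-bounded S = All.map⁺ (All.universal Fin.toℕ<n S)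

  k-bound : ∀ {h} → h ≤ 5 ⊎ (h + h ≤ suc (suc k)) ⊎ (h + h + R ≤ N + 2) → h + h ≤ k + 2
  -- The bound 10 is small enough because `k` is at least `R + 7`, which is at least 13.
  k-bound (inj₁ h≤5) = ≤-trans (+-mono-≤ h≤5 h≤5) (≤-trans (m≤m+n 10 5)
    (+-monoˡ-≤ 2 (≤-trans (+-monoˡ-≤ 7 6≤R) R+7≤k)))
  k-bound {h} (inj₂ (inj₁ le)) = subst (h + h ≤_) (+-comm 2 k) le
  k-bound (inj₂ (inj₂ le)) = +-cancelʳ-≤ R _ _ (≤-trans le (≤-reflexive (trans (cong (_+ 2) N≡R+k) (regroup R k))))
    where
    regroup : ∀ r k → r + k + 2 ≡ k + 2 + r
    regroup = solve-∀

  homPair-bound : ∀ {h} → HasHomPair extremal h → h + h ≤ k + 2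
  homPair-bound {h} (S₁ , S₂ , u₁ , u₂ , l₁ , l₂ , disj , hom) =
    combine (trans (length-map toℕ S₁) l₁) (trans (length-map toℕ S₂) l₂)
      (homometric-bound (≤-trans (s≤s (s≤s (s≤s z≤n))) 6≤R) {map toℕ S₁} {map toℕ S₂}
        (Unique.map⁺ Fin.toℕ-injective u₁) (Unique.map⁺ Fin.toℕ-injective u₂) (toℕ-disjoint disj)
        (trans (length-map toℕ S₁) (trans l₁ (trans (≡-sym l₂) (≡-sym (length-map toℕ S₂)))))
        (homometric-ℕ S₁ S₂ hom) (toℕ-bounded S₁) (toℕ-bounded S₂))
    where
    combine : ∀ {a b} → a ≡ h → b ≡ h → a ≤ 5 ⊎ (a + b ≤ suc (suc k)) ⊎ (a + b + R ≤ N + 2) → h + h ≤ k + 2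
    combine refl refl = k-bound

  m≤order : e ≤ order
  m≤order = ≤-trans (subst (e ≤_) (≡-sym R≡6+e) (m≤n+m e 6)) (≤-trans (m+n≤o⇒m≤o R R+9≤N) (m≤m+n N (suc k)))

  c : ℕ
  c = 2 * R + 7

  -- After adding `c` and doubling, the recursion for `level` is dominated by plain squaring, whence
  -- the double exponential.
  level-growth : ∀ j → 2 * (level j + c) ≤ (2 * c) ^ (2 ^ j)
  level-growth zero    = ≤-reflexive (≡-sym (^-identityʳ (2 * c)))
  level-growth (suc j) = begin
    2 * (level (suc j) + c)                              ≤⟨ square (level j) (2 * R + 6) ⟩
    2 * (level j + c) * (2 * (level j + c))              ≤⟨ *-mono-≤ (level-growth j) (level-growth j) ⟩
    (2 * c) ^ (2 ^ j) * (2 * c) ^ (2 ^ j)                ≡⟨ ^-distribˡ-+-* (2 * c) (2 ^ j) (2 ^ j) ⟨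
    (2 * c) ^ (2 ^ j + 2 ^ j)                            ≡⟨ cong (λ x → (2 * c) ^ (2 ^ j + x)) (+-identityʳ (2 ^ j)) ⟨
    (2 * c) ^ (2 ^ suc j)                                ∎
    where
    open ≤-Reasoning
    -- Written with `c = 1 + b`, the difference of the two sides has only nonnegative coefficients.
    expand : ∀ l b → 2 * (l + (2 * (l * l) + (1 + b)) + (1 + b)) + (6 * l + 8 * (l * b) + 4 * (b * b) + 4 * b)
                   ≡ 2 * (l + (1 + b)) * (2 * (l + (1 + b)))
    expand = solve-∀
    square : ∀ l b → 2 * (l + width l + c) ≤ 2 * (l + c) * (2 * (l + c))
    square l b = subst (λ c → 2 * (l + (2 * (l * l) + c) + c) ≤ 2 * (l + c) * (2 * (l + c))) (≡-sym (+-suc (2 * R) 6))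
      (≤-trans (m≤m+n _ _) (≤-reflexive (expand l (2 * R + 6))))

  -- At `e = 0` this is 38 ≤ 64; 6 is the first exponent for which the linear side is not the larger
  -- one.
  38+4e≤64·2^e : ∀ e → 2 * (2 * (6 + e) + 7) ≤ 2 ^ (6 + e)
  38+4e≤64·2^e zero    = m≤m+n 38 26
  38+4e≤64·2^e (suc e) = begin
    2 * (2 * (6 + suc e) + 7)                     ≤⟨ m≤m+n _ (34 + 4 * e) ⟩
    2 * (2 * (6 + suc e) + 7) + (34 + 4 * e)      ≡⟨ regroup e ⟩
    2 * (2 * (2 * (6 + e) + 7))                   ≤⟨ *-monoʳ-≤ 2 (38+4e≤64·2^e e) ⟩
    2 ^ (6 + suc e)                               ∎
    where
    open ≤-Reasoning
    regroup : ∀ e → 2 * (2 * (6 + suc e) + 7) + (34 + 4 * e) ≡ 2 * (2 * (2 * (6 + e) + 7))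
    regroup = solve-∀

  2c≤2^R : 2 * c ≤ 2 ^ R
  2c≤2^R = subst (λ r → 2 * (2 * r + 7) ≤ 2 ^ r) (≡-sym R≡6+e) (38+4e≤64·2^e e)

  order≤ : order ≤ 2 ^ (2 ^ (R + R))
  order≤ = begin
    N + suc k                ≤⟨ +-monoʳ-≤ N (≤-trans (+-monoˡ-≤ k (≤-trans (s≤s z≤n) 6≤R)) (≤-reflexive (≡-sym N≡R+k))) ⟩
    N + N                    ≤⟨ +-mono-≤ (m≤m+n N c) (≤-trans (m≤m+n N c) (m≤m+n _ 0)) ⟩
    2 * (N + c)              ≤⟨ level-growth R ⟩
    (2 * c) ^ (2 ^ R)        ≤⟨ ^-monoˡ-≤ (2 ^ R) 2c≤2^R ⟩
    (2 ^ R) ^ (2 ^ R)        ≡⟨ ^-*-assoc 2 R (2 ^ R) ⟩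
    2 ^ (R * 2 ^ R)          ≤⟨ ^-monoʳ-≤ 2 (*-monoˡ-≤ (2 ^ R) (≤-trans R≤2c 2c≤2^R)) ⟩
    2 ^ (2 ^ R * 2 ^ R)      ≡⟨ cong (2 ^_) (^-distribˡ-+-* 2 R R) ⟨
    2 ^ (2 ^ (R + R))        ∎
    where
    open ≤-Reasoning
    R≤2c : R ≤ 2 * c
    R≤2c = ≤-trans (m≤m+n R _) (≤-trans (m≤m+n (2 * R) 7) (m≤m+n c _))

  loglog≤ : ⌊log₂ ⌊log₂ order ⌋ ⌋ ≤ R + R
  loglog≤ = begin
    ⌊log₂ ⌊log₂ order ⌋ ⌋                   ≤⟨ ⌊log₂⌋-mono-≤ (⌊log₂⌋-mono-≤ order≤) ⟩
    ⌊log₂ ⌊log₂ 2 ^ (2 ^ (R + R)) ⌋ ⌋       ≡⟨ cong ⌊log₂_⌋ (⌊log₂[2^n]⌋≡n (2 ^ (R + R))) ⟩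
    ⌊log₂ 2 ^ (R + R) ⌋                     ≡⟨ ⌊log₂[2^n]⌋≡n (R + R) ⟩
    R + R                                   ∎
    where open ≤-Reasoning

  final-bound : ∀ {h} → h + h ≤ k + 2 → 4 * 16 * h + 4 * 1 * ⌊log₂ ⌊log₂ order ⌋ ⌋ ≤ 16 * order
  final-bound {h} le = begin
    4 * 16 * h + 4 * 1 * ⌊log₂ ⌊log₂ order ⌋ ⌋  ≤⟨ +-monoʳ-≤ (4 * 16 * h) (*-monoʳ-≤ 4 loglog≤) ⟩
    4 * 16 * h + 4 * 1 * (R + R)                ≡⟨ cong (_+ 4 * 1 * (R + R)) (quarter h) ⟩
    32 * (h + h) + 4 * 1 * (R + R)              ≤⟨ +-monoˡ-≤ (4 * 1 * (R + R)) (*-monoʳ-≤ 32 le) ⟩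
    -- As `order` is `R + 2 * k + 1`, the slack is `8 * R - 48`, which is `8 * e`; this again needs
    -- `R` to be at least 6.
    32 * (k + 2) + 4 * 1 * (R + R)              ≤⟨ m≤m+n _ (8 * e) ⟩
    32 * (k + 2) + 4 * 1 * (R + R) + 8 * e      ≡⟨ cong (λ r → 32 * (k + 2) + 4 * 1 * (r + r) + 8 * e) R≡6+e ⟩
    32 * (k + 2) + 4 * 1 * (6 + e + (6 + e)) + 8 * e  ≡⟨ regroup k e ⟩
    16 * (6 + e + k + suc k)                    ≡⟨ cong (λ r → 16 * (r + k + suc k)) R≡6+e ⟨
    16 * (R + k + suc k)                        ≡⟨ cong (λ x → 16 * (x + suc k)) N≡R+k ⟨
    16 * order                                  ∎
    where
    open ≤-Reasoning
    quarter : ∀ h → 4 * 16 * h ≡ 32 * (h + h)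
    quarter = solve-∀
    regroup : ∀ k e → 32 * (k + 2) + 4 * 1 * (6 + e + (6 + e)) + 8 * e ≡ 16 * (6 + e + k + suc k)
    regroup = solve-∀

  extremal-order : Σ ℕ λ n → e ≤ n × 0 < n × Σ ℕ λ hn → IsHn n hn ×
    4 * 16 * hn + 4 * 1 * ⌊log₂ ⌊log₂ n ⌋ ⌋ ≤ 16 * n
  extremal-order = conclude (isHn-exists extremal) (isH-exists extremal)
    where
    conclude : ∃ (IsHn order) → ∃ (IsH extremal) → _
    conclude (hn , isHn) (h , isH) = order , m≤order , ≤-trans 1≤N (m≤m+n _ _) , hn , isHn ,
      final-bound {hn} (≤-trans (+-mono-≤ hn≤h hn≤h) (homPair-bound (proj₁ isH)))
      where
      hn≤h : hn ≤ h
      hn≤h = proj₂ isHn extremal h isH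

theorem2 : Σ ℕ λ p → Σ ℕ λ q → 0 < p × 0 < q ×
    ((m : ℕ) → Σ ℕ λ n → m ≤ n × 0 < n × Σ ℕ λ hn → IsHn n hn ×
    4 * q * hn + 4 * p * ⌊log₂ ⌊log₂ n ⌋ ⌋ ≤ q * n)
-- The constant is p/q = 1/16, and the order grows beyond any given `m` because it is at least
-- `R = 6 + m`.
theorem2 = 1 , 16 , s≤s z≤n , s≤s z≤n , λ m → Extremal.extremal-order m (6 + m) refl
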